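{- Fix $N\ge2$ and consider prefixes for $\mathrm{Av}_N(321)$ of size at most $N-1$ (including the empty prefix), with trigger probabilities regarded as pairs (numerator, denominator). (1) If $p$ contains at least one inversion, then $\mathcal{T}_N(p)=\mathcal{T}_{N-1}(\check p)$, where $\check p$ is obtained from $p$ by removing the value $1$ and flattening, and $\mathcal{T}_{N-1}$ is computed with respect to $\mathrm{Av}_{N-1}(321)$. (2) If $p=12\cdots k$ with $0\le k\le N-1$ ($k=0$ meaning the empty prefix), then $\mathcal{T}_N(p)$ has numerator $k\binom{N-1}{k+1}+\binom{N-1}{k}$ and denominator $\frac{k+1}{N+1}\binom{2N-k}{N}$.
   Context: $\mathrm{Av}_N(321)$ is the set of permutations $\pi=\pi_1\cdots\pi_N$ of $[N]$ with no indices $a<b<c$ such that $\pi_a>\pi_b>\pi_c$. $\pi|_{[k]}$ is the permutation of $[k]$ in the same relative order as $\pi_1,\dots,\pi_k$ ($\pi|_{[0]}$ is empty). A prefix of size $k$ is any $\pi|_{[k]}$ with $\pi\in\mathrm{Av}_N(321)$; it contains an inversion if $p_a>p_b$ for some $a<b$. An entry $\pi_j$ is a left-to-right maximum if $\pi_j>\pi_l$ for all $l<j$. For a prefix $p$ of size $k\le N-1$, $\pi$ is won by triggering at $p$ if $\pi|_{[k]}=p$ and the first position $j>k$ at which $\pi_j$ is a left-to-right maximum satisfies $\pi_j=N$. The trigger probability is the pair $\mathcal{T}_N(p)=\big(\#\{\pi\in\mathrm{Av}_N(321)\text{ won by triggering at }p\},\ \#\{\pi\in\mathrm{Av}_N(321):\pi|_{[k]}=p\}\big)$.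 -}

module Defs where

open import Data.Bool using (Bool; true; false; if_then_else_; _∧_; _∨_; not)
open import Data.Nat using (ℕ; zero; suc; _+_; _*_; _∸_; _⊔_; _<ᵇ_; _≡ᵇ_)
open import Data.List using (List; []; _∷_; length; map; filterᵇ; take; drop; concatMap; upTo; foldr)
open import Data.Product using (Σ; _×_; _,_)
open import Data.Bool.ListAction using (any; all)
open import Relation.Binary.PropositionalEquality using (_≡_)
open import Data.List.Membership.Propositional using (_∈_)

range1 : ℕ → List ℕ
range1 n = map suc (upTo n)

words : List ℕ → ℕ → List (List ℕ)
words xs zero = [] ∷ []
words xs (suc n) = concatMap (λ x → map (x ∷_) (words xs n)) xs

count : ℕ → List ℕ → ℕ
count v [] = 0
count v (x ∷ xs) = if x ≡ᵇ v then suc (count v xs) else count v xs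

isPermᵇ : ℕ → List ℕ → Bool
isPermᵇ N π = (length π ≡ᵇ N) ∧ all (λ v → count v π ≡ᵇ 1) (range1 N)

has321 : List ℕ → Bool
has321 [] = false
has321 (x ∷ xs) = startsAt xs ∨ has321 xs
  where
  startsAt : List ℕ → Bool
  startsAt [] = false
  startsAt (y ∷ ys) = ((y <ᵇ x) ∧ any (λ z → z <ᵇ y) ys) ∨ startsAt ys

-- Av_N(321), as the list of all 321-avoiding permutations of [N] (each exactly once)
Av : ℕ → List (List ℕ)
Av N = filterᵇ (λ π → isPermᵇ N π ∧ not (has321 π)) (words (range1 N) N)

flatten : List ℕ → List ℕ
flatten xs = map (λ x → suc (length (filterᵇ (λ y → y <ᵇ x) xs))) xs

restrict : List ℕ → ℕ → List ℕ
restrict π k = flatten (take k π)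

_==_ : List ℕ → List ℕ → Bool
[] == [] = true
[] == (_ ∷ _) = false
(_ ∷ _) == [] = false
(x ∷ xs) == (y ∷ ys) = (x ≡ᵇ y) ∧ (xs == ys)

hasInversion : List ℕ → Bool
hasInversion [] = false
hasInversion (x ∷ xs) = any (λ y → y <ᵇ x) xs ∨ hasInversion xs

maxList : List ℕ → ℕ
maxList = foldr _⊔_ 0

-- scanning the suffix π_{k+1} π_{k+2} ..., with m the maximum of all earlier entries:
-- the first entry exceeding all earlier entries (= first left-to-right maximum after
-- position k) must equal N; false if there is no such entry
firstLRMaxIs : ℕ → ℕ → List ℕ → Bool
firstLRMaxIs N m [] = false
firstLRMaxIs N m (x ∷ xs) = if m <ᵇ x then x ≡ᵇ N else firstLRMaxIs N m xs

wonAt : ℕ → ℕ → List ℕ → Bool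
wonAt N k π = firstLRMaxIs N (maxList (take k π)) (drop k π)

IsPrefix : ℕ → List ℕ → Set
IsPrefix N p = Σ (List ℕ) (λ π → (π ∈ Av N) × (restrict π (length p) ≡ p))

trigger : ℕ → List ℕ → ℕ × ℕ
trigger N p =
  length (filterᵇ (λ π → (restrict π k == p) ∧ wonAt N k π) (Av N)) ,
  length (filterᵇ (λ π → restrict π k == p) (Av N))
  where k = length p

removeOne : List ℕ → List ℕ
removeOne p = flatten (filterᵇ (λ x → not (x ≡ᵇ 1)) p)

{-# OPTIONS --safe #-}
module Submission where

open import Defs
open import Data.Bool using (Bool; true; false; if_then_else_; _∧_; _∨_; not; T)
open import Data.Bool.ListAction using (any; or)
open import Data.Bool.Properties using (∨-zeroʳ; ∧-zeroʳ; ∧-idem; ∧-identityʳ; T?; T-∧; T-≡; T-not-≡)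
open import Data.Empty using (⊥-elim)
open import Data.Nat
  using (ℕ; zero; suc; _+_; _*_; _∸_; _≤_; _<_; z≤n; s≤s; s≤s⁻¹; _⊔_; _⊓_; _<ᵇ_; _≡ᵇ_)
open import Data.Nat.Combinatorics
  using (_C_; nCk+nC[k+1]≡[n+1]C[k+1]; nCn≡1; nC1≡n; nCk≡nC[n∸k]; k>n⇒nCk≡0)
open import Data.Nat.ListAction using (sum)
open import Data.Nat.ListAction.Properties using (sum-↭; sum-++)
open import Data.Nat.Properties
open import Data.Nat.Tactic.RingSolver using (solve-∀)
open import Data.List using (List; []; _∷_; length; map; filterᵇ; take; drop; concatMap; upTo)
open import Data.List.Membership.Propositional using (_∈_; find; lose)
open import Data.List.Membership.Propositional.Properties
  using (∈-filter⁺; ∈-filter⁻; ∈-upTo⁺; ∈-upTo⁻; ∈-map⁺; ∈-map⁻; ∈-concatMap⁺; ∈-concatMap⁻)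
open import Data.List.Membership.Propositional.Properties.WithK using (unique∧set⇒bag)
open import Data.List.Properties
  using (length-map; length-upTo; length-take; map-∘; map-++; map-upTo; map-cong-local; map-injective;
         ∷-injective; take-map; take-all; take-take; drop-map; drop-all; drop-[])
open import Data.List.Relation.Binary.BagAndSetEquality using (∼bag⇒↭)
open import Data.List.Relation.Binary.Permutation.Propositional using (_↭_)
open import Data.List.Relation.Binary.Permutation.Propositional.Properties using () renaming (map⁺ to ↭-map⁺)
open import Data.List.Relation.Unary.All as All using (All; []; _∷_)
open import Data.List.Relation.Unary.All.Properties as Allₚ using (all⁺; all⁻)
open import Data.List.Relation.Unary.AllPairs using ([]; _∷_)
open import Data.List.Relation.Unary.Any using (here; there)
open import Data.List.Relation.Unary.Unique.Propositional using (Unique)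
import Data.List.Relation.Unary.Unique.Propositional.Properties as Unique
open import Data.Product using (∃; ∃₂; _×_; _,_; proj₁; proj₂)
open import Data.Unit using (tt)
open import Relation.Binary.Definitions using (tri<; tri≈; tri>)
open import Relation.Nullary using (yes; no)
open import Function using (_∘_; id; mk⇔; Equivalence)
open import Relation.Binary.PropositionalEquality
  using (_≡_; _≢_; refl; sym; trans; cong; cong₂; subst; module ≡-Reasoning)

open Equivalence using (to; from)

-- Removing the value 1 turns a 321-avoiding permutation of [N+1] into one of [N]; conversely 1 may be
-- inserted at index i exactly when the first i entries increase. So Av (N+1) is a tree of children over
-- Av N, and every count over Av (N+1) is a sum over pairs (π, i). If p has an inversion, the value 1 lies
-- inside p, so p determines i and the sum collapses to the count for p̌. If p = 12⋯k, then i = 0 or i ≥ k.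
-- This gives D(N+1,k) = D(N,k−1) + D(N+1,k+1) for the denominator, and for the numerator
-- W(N+1,k) = W(N,k−1) + W(N,k) + M(N,k), where M(N,k) counts the π with π₁ < ⋯ < πₖ₊₁ = N and satisfies
-- Pascal's rule.

-- Deleting the value 1 suits the winning rule: an inserted 1 that follows some entry is never a
-- left-to-right maximum, and raising the other entries by one turns a maximum N into N+1, so
-- winning passes unchanged between parent and child. The difficulty is the unbounded range of
-- admissible i ≥ k. For the numerator (k ≥ 1) it cuts itself off: if i ≥ k+2 is admissible, then
-- πₖ₊₁ < πₖ₊₂, the next left-to-right maximum is πₖ₊₁ < N, and nothing is won. Index k contributes
-- W(N,k), and index k+1 contributes M(N,k), since there one more entry has to be in increasing
-- position. For the denominator there is no such cutoff. There the prefix lengths k and k+1 are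
-- compared: every admissible index above k counts for both, so they differ only at the indices 0
-- and k, and the two occurrences of D(N,k) cancel.

-- If i exceeds the length of the list, ins i still appends the 1 at the end.
ins : ℕ → List ℕ → List ℕ
ins zero xs = 1 ∷ map suc xs
ins (suc i) [] = 1 ∷ []
ins (suc i) (x ∷ xs) = suc x ∷ ins i xs

-- Makes the inserted 1 strictly smallest. With an entry 0 insertion would be ambiguous: indices 0
-- and 1 both turn the list `0 ∷ []` into `1 ∷ 1 ∷ []`.
Positive : List ℕ → Set
Positive = All (1 ≤_)

-- Inversions, 321-patterns and multiplicities under insertion of a 1

length-ins : ∀ i xs → length (ins i xs) ≡ suc (length xs)
length-ins zero xs = cong suc (length-map suc xs)
length-ins (suc i) [] = refl
length-ins (suc i) (x ∷ xs) = cong suc (length-ins i xs)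

take-ins-≤ : ∀ {i k} xs → i ≤ k → take (suc k) (ins i xs) ≡ ins i (take k xs)
take-ins-≤ {k = k} xs z≤n = cong (1 ∷_) (take-map k xs)
take-ins-≤ [] (s≤s i≤k) = refl
take-ins-≤ (x ∷ xs) (s≤s i≤k) = cong (suc x ∷_) (take-ins-≤ xs i≤k)

drop-ins-≤ : ∀ {i k} xs → i ≤ k → drop (suc k) (ins i xs) ≡ map suc (drop k xs)
drop-ins-≤ {k = k} xs z≤n = drop-map k xs
drop-ins-≤ [] (s≤s i≤k) = refl
drop-ins-≤ (x ∷ xs) (s≤s i≤k) = drop-ins-≤ xs i≤k

take-ins-≥ : ∀ {i k} xs → k ≤ i → i ≤ length xs → take k (ins i xs) ≡ map suc (take k xs)
take-ins-≥ xs z≤n i≤n = refl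
take-ins-≥ (x ∷ xs) (s≤s k≤i) (s≤s i≤n) = cong (suc x ∷_) (take-ins-≥ xs k≤i i≤n)

drop-ins-≥ : ∀ {i k} xs → k ≤ i → i ≤ length xs → drop k (ins i xs) ≡ ins (i ∸ k) (drop k xs)
drop-ins-≥ xs z≤n i≤n = refl
drop-ins-≥ (x ∷ xs) (s≤s k≤i) (s≤s i≤n) = drop-ins-≥ xs k≤i i≤n

any<-map : ∀ v xs → any (_<ᵇ suc v) (map suc xs) ≡ any (_<ᵇ v) xs
any<-map v [] = refl
any<-map v (x ∷ xs) = cong ((x <ᵇ v) ∨_) (any<-map v xs)

any<1-map : ∀ xs → any (_<ᵇ 1) (map suc xs) ≡ false
any<1-map [] = refl
any<1-map (x ∷ xs) = any<1-map xs

any<-ins : ∀ {v} i xs → 1 ≤ v → any (_<ᵇ suc v) (ins i xs) ≡ true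
any<-ins zero xs (s≤s _) = refl
any<-ins (suc i) [] (s≤s _) = refl
any<-ins {v} (suc i) (x ∷ xs) 1≤v =
  trans (cong ((x <ᵇ v) ∨_) (any<-ins i xs 1≤v)) (∨-zeroʳ (x <ᵇ v))

hasInversion-map : ∀ xs → hasInversion (map suc xs) ≡ hasInversion xs
hasInversion-map [] = refl
hasInversion-map (x ∷ xs) = cong₂ _∨_ (any<-map x xs) (hasInversion-map xs)

hasInversion-ins-zero : ∀ xs → hasInversion (ins 0 xs) ≡ hasInversion xs
hasInversion-ins-zero xs = cong₂ _∨_ (any<1-map xs) (hasInversion-map xs)

hasInversion-ins-suc : ∀ {i xs} → Positive xs → i < length xs → hasInversion (ins (suc i) xs) ≡ true
hasInversion-ins-suc {i} {x ∷ xs} (1≤x ∷ _) _ = cong (_∨ hasInversion (ins i xs)) (any<-ins i xs 1≤x)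

begins321 : ℕ → List ℕ → Bool
begins321 x [] = false
begins321 x (y ∷ ys) = ((y <ᵇ x) ∧ any (_<ᵇ y) ys) ∨ begins321 x ys

-- The hypothesis identifies `s` and `s′` only where `h` is false; where `h` is true, both sides are
-- true anyway.
∨-congˡ-absorb : ∀ a {s s′} b h → s ∨ h ≡ s′ ∨ h → (a ∨ s) ∨ (b ∨ h) ≡ (a ∨ s′) ∨ (b ∨ h)
∨-congˡ-absorb true b h e = refl
∨-congˡ-absorb false {s} {s′} true h e = trans (∨-zeroʳ s) (sym (∨-zeroʳ s′))
∨-congˡ-absorb false false h e = e

-- The helper local to has321 cannot be named here; the two sides are compared through
-- has321 itself, which absorbs the difference.
has321-∷ : ∀ x xs → has321 (x ∷ xs) ≡ begins321 x xs ∨ has321 xs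
has321-∷ x [] = refl
has321-∷ x (y ∷ ys) =
  ∨-congˡ-absorb ((y <ᵇ x) ∧ any (_<ᵇ y) ys) _ (has321 ys) (has321-∷ x ys)

begins321-map : ∀ x xs → begins321 (suc x) (map suc xs) ≡ begins321 x xs
begins321-map x [] = refl
begins321-map x (y ∷ ys) = cong₂ (λ a b → ((y <ᵇ x) ∧ a) ∨ b) (any<-map y ys) (begins321-map x ys)

begins321-1 : ∀ xs → begins321 1 (map suc xs) ≡ false
begins321-1 [] = refl
begins321-1 (x ∷ xs) = begins321-1 xs

-- A smallest entry can only end a 321-pattern. So a new pattern led by the raised `x` is a smaller
-- middle entry among the first `i`, followed by the 1.
begins321-ins : ∀ x i {xs} → 1 ≤ x → Positive xs →
  begins321 (suc x) (ins i xs) ≡ any (_<ᵇ x) (take i xs) ∨ begins321 x xs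
begins321-ins (suc x) zero {xs} _ _ rewrite any<1-map xs = begins321-map (suc x) xs
begins321-ins (suc x) (suc i) {[]} _ _ = refl
begins321-ins x (suc i) {y ∷ ys} 1≤x (1≤y ∷ ys≥1)
  rewrite any<-ins i ys 1≤y | begins321-ins x i 1≤x ys≥1 =
  absorb (y <ᵇ x) (any (_<ᵇ x) (take i ys)) (any (_<ᵇ y) ys) (begins321 x ys)
  where
  absorb : ∀ a b c d → (a ∧ true) ∨ (b ∨ d) ≡ (a ∨ b) ∨ ((a ∧ c) ∨ d)
  absorb true b c d = refl
  absorb false b c d = refl

has321-map : ∀ xs → has321 (map suc xs) ≡ has321 xs
has321-map [] = refl
has321-map (x ∷ xs) = trans (has321-∷ (suc x) (map suc xs))
  (trans (cong₂ _∨_ (begins321-map x xs) (has321-map xs)) (sym (has321-∷ x xs)))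

has321-ins : ∀ i {xs} → Positive xs → has321 (ins i xs) ≡ hasInversion (take i xs) ∨ has321 xs
has321-ins zero {xs} _ =
  trans (has321-∷ 1 (map suc xs)) (cong₂ _∨_ (begins321-1 xs) (has321-map xs))
has321-ins (suc i) [] = refl
has321-ins (suc i) {x ∷ xs} (1≤x ∷ xs≥1)
  rewrite has321-∷ x xs | has321-∷ (suc x) (ins i xs)
        | begins321-ins x i 1≤x xs≥1 | has321-ins i xs≥1 =
  interchange (any (_<ᵇ x) (take i xs)) (begins321 x xs) (hasInversion (take i xs)) (has321 xs)
  where
  interchange : ∀ a b c d → (a ∨ b) ∨ (c ∨ d) ≡ (a ∨ c) ∨ (b ∨ d)
  interchange true b c d = refl
  interchange false true true d = refl
  interchange false true false d = refl
  interchange false false c d = refl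

-- The admissibility test for index `i`, phrased through inversions because this is the term that
-- `has321-ins` produces.
inc : ℕ → List ℕ → Bool
inc i xs = not (hasInversion (take i xs))

-- Where the indices differ, a 1 would have to equal a raised positive entry. The bounds are
-- essential: all indices past the end append the 1 and give the same list.
ins-injective : ∀ i j {xs ys} → i ≤ length xs → j ≤ length ys → Positive xs → Positive ys →
  ins i xs ≡ ins j ys → i ≡ j × xs ≡ ys
ins-injective zero zero _ _ _ _ eq = refl , map-suc-injective (proj₂ (∷-injective eq))
  where
  map-suc-injective : ∀ {xs ys} → map suc xs ≡ map suc ys → xs ≡ ys
  map-suc-injective = map-injective suc-injective
ins-injective zero (suc j) {ys = zero ∷ ys} _ _ _ (() ∷ _) eq
ins-injective (suc i) zero {xs = zero ∷ xs} _ _ (() ∷ _) _ eq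
ins-injective (suc i) (suc j) {x ∷ xs} {y ∷ ys} (s≤s i≤) (s≤s j≤) (_ ∷ xs≥1) (_ ∷ ys≥1) eq
  with refl , eq′ ← ∷-injective eq
  with refl , refl ← ins-injective i j i≤ j≤ xs≥1 ys≥1 eq′ = refl , refl

All-ins⁺ : ∀ {P : ℕ → Set} i {xs} → P 1 → All (P ∘ suc) xs → All P (ins i xs)
All-ins⁺ zero p ps = p ∷ Allₚ.map⁺ ps
All-ins⁺ (suc i) p [] = p ∷ []
All-ins⁺ (suc i) p (q ∷ ps) = q ∷ All-ins⁺ i p ps

All-ins⁻ : ∀ {P : ℕ → Set} i {xs} → All P (ins i xs) → All (P ∘ suc) xs
All-ins⁻ zero (p ∷ ps) = Allₚ.map⁻ ps
All-ins⁻ (suc i) {[]} ps = []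
All-ins⁻ (suc i) {x ∷ xs} (p ∷ ps) = p ∷ All-ins⁻ i ps

count-map-suc : ∀ v xs → count (suc v) (map suc xs) ≡ count v xs
count-map-suc v [] = refl
count-map-suc v (x ∷ xs) rewrite count-map-suc v xs = refl

count-ins : ∀ v i xs → count (suc (suc v)) (ins i xs) ≡ count (suc v) xs
count-ins v zero xs = count-map-suc (suc v) xs
count-ins v (suc i) [] = refl
count-ins v (suc i) (x ∷ xs) rewrite count-ins v i xs = refl

count-0 : ∀ {xs} → Positive xs → count 0 xs ≡ 0
count-0 [] = refl
count-0 (s≤s _ ∷ xs≥1) = count-0 xs≥1

count-1-ins : ∀ i {xs} → Positive xs → count 1 (ins i xs) ≡ 1
count-1-ins zero {xs} xs≥1 = cong suc (trans (count-map-suc 0 xs) (count-0 xs≥1))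
count-1-ins (suc i) [] = refl
count-1-ins (suc i) (s≤s _ ∷ xs≥1) = count-1-ins i xs≥1

unshift : ∀ {xs} → Positive xs → count 1 xs ≡ 0 → ∃ λ ys → Positive ys × xs ≡ map suc ys
unshift [] _ = [] , [] , refl
unshift {suc (suc x) ∷ xs} (_ ∷ xs≥1) c with ys , ys≥1 , refl ← unshift xs≥1 c =
  suc x ∷ ys , s≤s z≤n ∷ ys≥1 , refl

delete1 : ∀ {xs} → Positive xs → count 1 xs ≡ 1 →
  ∃₂ λ i ys → i ≤ length ys × Positive ys × xs ≡ ins i ys
delete1 {suc zero ∷ xs} (_ ∷ xs≥1) c with ys , ys≥1 , refl ← unshift xs≥1 (suc-injective c) =
  0 , ys , z≤n , ys≥1 , refl
delete1 {suc (suc x) ∷ xs} (_ ∷ xs≥1) c with i , ys , i≤ , ys≥1 , refl ← delete1 xs≥1 c =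
  suc i , suc x ∷ ys , s≤s i≤ , s≤s z≤n ∷ ys≥1 , refl

∈-range1⁺ : ∀ {v N} → 1 ≤ v → v ≤ N → v ∈ range1 N
∈-range1⁺ (s≤s z≤n) v≤N = ∈-map⁺ suc (∈-upTo⁺ v≤N)

∈-range1⁻ : ∀ {v N} → v ∈ range1 N → 1 ≤ v × v ≤ N
∈-range1⁻ v∈ with _ , w∈ , refl ← ∈-map⁻ suc v∈ = s≤s z≤n , ∈-upTo⁻ w∈

∈-words⁺ : ∀ {xs} {w : List ℕ} → All (_∈ xs) w → w ∈ words xs (length w)
∈-words⁺ [] = here refl
∈-words⁺ {xs} (x∈ ∷ w∈) = ∈-concatMap⁺ _ (lose x∈ (∈-map⁺ (_ ∷_) (∈-words⁺ w∈)))

∈-words⁻ : ∀ {xs} n {w} → w ∈ words xs n → length w ≡ n × All (_∈ xs) w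
∈-words⁻ zero (here refl) = refl , []
∈-words⁻ {xs} (suc n) w∈
  with x , x∈ , w∈′ ← find (∈-concatMap⁻ (λ x → map (x ∷_) (words xs n)) {xs = xs} w∈)
  with v , v∈ , refl ← ∈-map⁻ (x ∷_) w∈′
  with refl , v⊆ ← ∈-words⁻ n v∈ = refl , x∈ ∷ v⊆

not≡true⇒≡false : ∀ {b} → not b ≡ true → b ≡ false
not≡true⇒≡false {false} _ = refl

∨-≡-false : ∀ {a b} → a ∨ b ≡ false → a ≡ false × b ≡ false
∨-≡-false {false} eq = refl , eq

-- The generating tree of 321-avoiding permutations

-- The boolean test behind `Av`, unpacked; `positive` and `bounded` record that the letters come
-- from `range1 N`.
record Avoider (N : ℕ) (π : List ℕ) : Set where
  constructor avoider
  field
    size     : length π ≡ N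
    positive : Positive π
    bounded  : All (_≤ N) π
    once     : ∀ {v} → 1 ≤ v → v ≤ N → count v π ≡ 1
    avoids   : has321 π ≡ false

open Avoider

fits : ∀ {N i π} → Avoider N π → i ≤ N → i ≤ length π
fits a = subst (_ ≤_) (sym (size a))

∈-Av⁻ : ∀ N {π} → π ∈ Av N → Avoider N π
∈-Av⁻ N {π} π∈
  with π∈w , ok ← ∈-filter⁻ (λ π → T? (isPermᵇ N π ∧ not (has321 π))) {xs = words (range1 N) N} π∈
  with perm , av ← to (T-∧ {isPermᵇ N π}) ok
  with len , cnt ← to (T-∧ {length π ≡ᵇ N}) perm = record
  { size     = ≡ᵇ⇒≡ _ _ len
  ; positive = All.map (proj₁ ∘ ∈-range1⁻) letters
  ; bounded  = All.map (proj₂ ∘ ∈-range1⁻) letters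
  ; once     = λ 1≤v v≤N → ≡ᵇ⇒≡ _ _ (All.lookup (all⁺ _ (range1 N) cnt) (∈-range1⁺ 1≤v v≤N))
  ; avoids   = to T-not-≡ av
  }
  where letters = proj₂ (∈-words⁻ N π∈w)

∈-Av⁺ : ∀ N {π} → Avoider N π → π ∈ Av N
∈-Av⁺ N {π} (avoider refl pos bnd one av) =
  ∈-filter⁺ (λ π → T? (isPermᵇ N π ∧ not (has321 π)))
    (∈-words⁺ (All.zipWith (λ (p , b) → ∈-range1⁺ p b) (pos , bnd)))
    (from T-∧ (from (T-∧ {length π ≡ᵇ N}) (≡⇒≡ᵇ N N refl , all⁻ _ counts) , from T-not-≡ av))
  where
  counts : All (λ v → T (count v π ≡ᵇ 1)) (range1 N)
  counts = All.tabulate λ v∈ → let 1≤v , v≤N = ∈-range1⁻ v∈ in ≡⇒≡ᵇ _ 1 (one 1≤v v≤N)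

Avoider-ins : ∀ {N π i} → Avoider N π → inc i π ≡ true → Avoider (suc N) (ins i π)
Avoider-ins {N} {π} {i} a up = record
  { size     = trans (length-ins i π) (cong suc (size a))
  ; positive = All-ins⁺ i (s≤s z≤n) (All.map (λ _ → s≤s z≤n) (positive a))
  ; bounded  = All-ins⁺ i (s≤s z≤n) (All.map s≤s (bounded a))
  ; once     = one
  ; avoids   = trans (has321-ins i (positive a)) (cong₂ _∨_ (not≡true⇒≡false up) (avoids a))
  }
  where
  one : ∀ {v} → 1 ≤ v → v ≤ suc N → count v (ins i π) ≡ 1
  one {suc zero} _ _ = count-1-ins i (positive a)
  one {suc (suc v)} _ (s≤s v≤N) = trans (count-ins v i π) (once a (s≤s z≤n) v≤N)

Avoider-delete1 : ∀ {N π} → Avoider (suc N) π →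
  ∃₂ λ i ρ → π ≡ ins i ρ × Avoider N ρ × i ≤ N × inc i ρ ≡ true
Avoider-delete1 {N} {π} a
  with i , ρ , i≤ , ρ≥1 , refl ← delete1 (positive a) (once a (s≤s z≤n) (s≤s z≤n))
  with refl ← suc-injective (trans (sym (length-ins i ρ)) (size a)) =
  i , ρ , refl
  , avoider refl ρ≥1 (All.map s≤s⁻¹ (All-ins⁻ i (bounded a))) one (proj₂ both)
  , i≤ , cong not (proj₁ both)
  where
  both = ∨-≡-false (trans (sym (has321-ins i ρ≥1)) (avoids a))
  one : ∀ {v} → 1 ≤ v → v ≤ length ρ → count v ρ ≡ 1
  one {suc v} _ v≤ = trans (sym (count-ins v i ρ)) (once a (s≤s z≤n) (s≤s v≤))

Unique-map⁺ : ∀ {A B : Set} {f : A → B} {xs} → Unique xs →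
  (∀ {x y} → x ∈ xs → y ∈ xs → f x ≡ f y → x ≡ y) → Unique (map f xs)
Unique-map⁺ [] _ = []
Unique-map⁺ (x∉ ∷ u) inj =
  Allₚ.map⁺ (All.tabulate λ y∈ eq → All.lookup x∉ y∈ (inj (here refl) (there y∈) eq))
  ∷ Unique-map⁺ u (λ p q → inj (there p) (there q))

Unique-concatMap⁺ : ∀ {A B : Set} (f : A → List B) {xs} → Unique xs →
  (∀ {x} → x ∈ xs → Unique (f x)) →
  (∀ {x y z} → x ∈ xs → y ∈ xs → z ∈ f x → z ∈ f y → x ≡ y) → Unique (concatMap f xs)
Unique-concatMap⁺ f [] _ _ = []
Unique-concatMap⁺ f {x ∷ xs} (x∉ ∷ u) uf inj =
  Unique.++⁺ (uf (here refl)) (Unique-concatMap⁺ f u (uf ∘ there) (λ p q → inj (there p) (there q)))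
    λ (z∈fx , z∈) → let y , y∈ , z∈fy = find (∈-concatMap⁻ f {xs = xs} z∈) in
      All.lookup x∉ y∈ (inj (here refl) (there y∈) z∈fx z∈fy)

words-unique : ∀ {xs} → Unique xs → ∀ n → Unique (words xs n)
words-unique u zero = [] ∷ []
words-unique {xs} u (suc n) = Unique-concatMap⁺ _ u
  (λ _ → Unique.map⁺ (proj₂ ∘ ∷-injective) (words-unique u n)) same-head
  where
  same-head : ∀ {x y z} → x ∈ xs → y ∈ xs →
    z ∈ map (x ∷_) (words xs n) → z ∈ map (y ∷_) (words xs n) → x ≡ y
  same-head _ _ z∈ z∈′ with _ , _ , refl ← ∈-map⁻ _ z∈ with _ , _ , refl ← ∈-map⁻ _ z∈′ = refl

Av-unique : ∀ N → Unique (Av N)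
Av-unique N = Unique.filter⁺ _ (words-unique (Unique.map⁺ suc-injective (Unique.upTo⁺ N)) N)

children : ℕ → List ℕ → List (List ℕ)
children N π = map (λ i → ins i π) (filterᵇ (λ i → inc i π) (upTo (suc N)))

∈-children⁻ : ∀ N {π ρ} → ρ ∈ children N π → ∃ λ i → ρ ≡ ins i π × i ≤ N × inc i π ≡ true
∈-children⁻ N {π} ρ∈ with i , i∈ , refl ← ∈-map⁻ _ ρ∈
  with i∈′ , ok ← ∈-filter⁻ (λ i → T? (inc i π)) {xs = upTo (suc N)} i∈ =
  i , refl , s≤s⁻¹ (∈-upTo⁻ i∈′) , to T-≡ ok

∈-children⁺ : ∀ N {π i} → i ≤ N → inc i π ≡ true → ins i π ∈ children N π
∈-children⁺ N {π} i≤N up =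
  ∈-map⁺ _ (∈-filter⁺ (λ i → T? (inc i π)) (∈-upTo⁺ (s≤s i≤N)) (from T-≡ up))

-- Both lists are free of duplicates and have the same members, hence are equal as bags; the order
-- in which `words` enumerates never has to be matched.
Av-suc : ∀ N → Av (suc N) ↭ concatMap (children N) (Av N)
Av-suc N = ∼bag⇒↭ (unique∧set⇒bag (Av-unique (suc N)) unique (mk⇔ split join))
  where
  split : ∀ {π} → π ∈ Av (suc N) → π ∈ concatMap (children N) (Av N)
  split π∈ with i , ρ , refl , ρ-av , i≤N , up ← Avoider-delete1 (∈-Av⁻ (suc N) π∈) =
    ∈-concatMap⁺ _ (lose (∈-Av⁺ N ρ-av) (∈-children⁺ N i≤N up))
  join : ∀ {π} → π ∈ concatMap (children N) (Av N) → π ∈ Av (suc N)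
  join π∈ with ρ , ρ∈ , π∈′ ← find (∈-concatMap⁻ (children N) {xs = Av N} π∈)
    with i , refl , _ , up ← ∈-children⁻ N π∈′ = ∈-Av⁺ (suc N) (Avoider-ins (∈-Av⁻ N ρ∈) up)
  -- A child determines its parent and its index. The first makes different families disjoint, the
  -- second makes the members of one family distinct.
  recover : ∀ {π ρ i j} → π ∈ Av N → ρ ∈ Av N → i ≤ N → j ≤ N → ins i π ≡ ins j ρ → i ≡ j × π ≡ ρ
  recover {π} {ρ} π∈ ρ∈ i≤N j≤N = let a = ∈-Av⁻ N π∈ ; b = ∈-Av⁻ N ρ∈ in
    ins-injective _ _ (fits a i≤N) (fits b j≤N) (positive a) (positive b)
  unique : Unique (concatMap (children N) (Av N))
  unique = Unique-concatMap⁺ (children N) (Av-unique N) unique-children same-parent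
    where
    same-parent : ∀ {π ρ σ} → π ∈ Av N → ρ ∈ Av N → σ ∈ children N π → σ ∈ children N ρ → π ≡ ρ
    same-parent π∈ ρ∈ σ∈ σ∈′
      with i , refl , i≤ , _ ← ∈-children⁻ N σ∈
      with j , eq , j≤ , _ ← ∈-children⁻ N σ∈′ =
      proj₂ (recover π∈ ρ∈ i≤ j≤ eq)
    unique-children : ∀ {π} → π ∈ Av N → Unique (children N π)
    unique-children {π} π∈ = Unique-map⁺ (Unique.filter⁺ (λ i → T? (inc i π)) (Unique.upTo⁺ (suc N)))
      λ i∈ j∈ eq → proj₁ (recover π∈ π∈ (small i∈) (small j∈) eq)
      where
      small : ∀ {i} → i ∈ filterᵇ (λ i → inc i π) (upTo (suc N)) → i ≤ N
      small i∈ = s≤s⁻¹ (∈-upTo⁻ (proj₁ (∈-filter⁻ (λ i → T? (inc i π)) {xs = upTo (suc N)} i∈)))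

-- Sums over the tree

⟦_⟧ : Bool → ℕ
⟦ b ⟧ = if b then 1 else 0

∑ : {A : Set} → List A → (A → ℕ) → ℕ
∑ xs f = sum (map f xs)

length-filterᵇ : ∀ {A : Set} (P : A → Bool) xs → length (filterᵇ P xs) ≡ ∑ xs (λ x → ⟦ P x ⟧)
length-filterᵇ P [] = refl
length-filterᵇ P (x ∷ xs) with P x
... | true = cong suc (length-filterᵇ P xs)
... | false = length-filterᵇ P xs

∑-cong : ∀ {A : Set} {f g : A → ℕ} xs → (∀ {x} → x ∈ xs → f x ≡ g x) → ∑ xs f ≡ ∑ xs g
∑-cong [] eq = refl
∑-cong (x ∷ xs) eq = cong₂ _+_ (eq (here refl)) (∑-cong xs (eq ∘ there))

∑-+ : ∀ {A : Set} (f g : A → ℕ) xs → ∑ xs (λ x → f x + g x) ≡ ∑ xs f + ∑ xs g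
∑-+ f g [] = refl
∑-+ f g (x ∷ xs) rewrite ∑-+ f g xs = interchange (f x) (g x) (∑ xs f) (∑ xs g)
  where
  interchange : ∀ a b c d → a + b + (c + d) ≡ a + c + (b + d)
  interchange = solve-∀

∑-map : ∀ {A B : Set} (f : A → B) (g : B → ℕ) xs → ∑ (map f xs) g ≡ ∑ xs (g ∘ f)
∑-map f g xs = cong sum (sym (map-∘ xs))

∑-filterᵇ : ∀ {A : Set} (P Q : A → Bool) xs →
  ∑ (filterᵇ P xs) (λ x → ⟦ Q x ⟧) ≡ ∑ xs (λ x → ⟦ P x ∧ Q x ⟧)
∑-filterᵇ P Q [] = refl
∑-filterᵇ P Q (x ∷ xs) with P x
... | true = cong (⟦ Q x ⟧ +_) (∑-filterᵇ P Q xs)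
... | false = ∑-filterᵇ P Q xs

∑-concatMap : ∀ {A B : Set} (f : A → List B) (g : B → ℕ) xs →
  ∑ (concatMap f xs) g ≡ ∑ xs (λ x → ∑ (f x) g)
∑-concatMap f g [] = refl
∑-concatMap f g (x ∷ xs) = trans (cong sum (map-++ g (f x) (concatMap f xs)))
  (trans (sum-++ (map g (f x)) _) (cong (∑ (f x) g +_) (∑-concatMap f g xs)))

-- Admissibility is moved from the filter into the summand, so that the range of `i` no longer
-- depends on `π`.
∑-Av-suc : ∀ N (P : List ℕ → Bool) → ∑ (Av (suc N)) (λ π → ⟦ P π ⟧) ≡
  ∑ (Av N) (λ π → ∑ (upTo (suc N)) (λ i → ⟦ inc i π ∧ P (ins i π) ⟧))
∑-Av-suc N P = begin
  ∑ (Av (suc N)) p                            ≡⟨ sum-↭ (↭-map⁺ p (Av-suc N)) ⟩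
  ∑ (concatMap (children N) (Av N)) p         ≡⟨ ∑-concatMap (children N) p (Av N) ⟩
  ∑ (Av N) (λ π → ∑ (children N π) p)         ≡⟨ ∑-cong (Av N) (λ {π} _ → over-children π) ⟩
  ∑ (Av N) (λ π → ∑ (upTo (suc N)) (λ i → ⟦ inc i π ∧ P (ins i π) ⟧)) ∎
  where
  open ≡-Reasoning
  p : List ℕ → ℕ
  p π = ⟦ P π ⟧
  over-children : ∀ π → ∑ (children N π) p ≡ ∑ (upTo (suc N)) (λ i → ⟦ inc i π ∧ P (ins i π) ⟧)
  over-children π = trans (∑-map (λ i → ins i π) p (filterᵇ (λ i → inc i π) (upTo (suc N))))
    (∑-filterᵇ (λ i → inc i π) (λ i → P (ins i π)) (upTo (suc N)))

-- A spike of height `c` at `k`. The contribution of the children is described pointwise in `i` by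
-- sums of spikes, which are then summed by `∑-δ`.
δ : ℕ → ℕ → ℕ → ℕ
δ k c i = if i ≡ᵇ k then c else 0

δ-≡ : ∀ k c → δ k c k ≡ c
δ-≡ zero c = refl
δ-≡ (suc k) c = δ-≡ k c

δ-≢ : ∀ {i k} c → i ≢ k → δ k c i ≡ 0
δ-≢ {zero} {zero} c i≢k = ⊥-elim (i≢k refl)
δ-≢ {zero} {suc k} c i≢k = refl
δ-≢ {suc i} {zero} c i≢k = refl
δ-≢ {suc i} {suc k} c i≢k = δ-≢ {i} {k} c (i≢k ∘ cong suc)

∑-upTo-suc : ∀ n (f : ℕ → ℕ) → ∑ (upTo (suc n)) f ≡ f 0 + ∑ (upTo n) (f ∘ suc)
∑-upTo-suc n f = cong (f 0 +_) (trans (cong (λ is → ∑ is f) (sym (map-upTo suc n))) (∑-map suc f (upTo n)))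

∑-zero : ∀ n → ∑ (upTo n) (λ _ → 0) ≡ 0
∑-zero zero = refl
∑-zero (suc n) = trans (∑-upTo-suc n (λ _ → 0)) (∑-zero n)

-- The hypothesis deals with a spike outside the range: its height must then be 0. This spares the
-- recurrences a case distinction on `k` against `N`.
∑-δ : ∀ n k {c} → (n ≤ k → c ≡ 0) → ∑ (upTo n) (δ k c) ≡ c
∑-δ zero k c≡0 = sym (c≡0 z≤n)
∑-δ (suc n) zero {c} c≡0 = trans (∑-upTo-suc n (δ 0 c)) (trans (cong (c +_) (∑-zero n)) (+-identityʳ c))
∑-δ (suc n) (suc k) {c} c≡0 = trans (∑-upTo-suc n (δ (suc k) c)) (∑-δ n k (c≡0 ∘ s≤s))

-- Increasing prefixes and winning under insertion of a 1

inc-ins-zero : ∀ k xs → inc (suc k) (ins 0 xs) ≡ inc k xs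
inc-ins-zero k xs rewrite take-map {f = suc} k xs = cong not (hasInversion-ins-zero (take k xs))

-- A 1 inside the prefix but not in front forms an inversion with the entry at its head.
inc-ins-low : ∀ {i k xs} → Positive xs → suc i ≤ k → suc i ≤ length xs → inc (suc k) (ins (suc i) xs) ≡ false
inc-ins-low {i} {k} {xs} xs≥1 i<k i<n rewrite take-ins-≤ xs i<k =
  cong not (hasInversion-ins-suc (Allₚ.take⁺ k xs≥1)
    (subst (suc i ≤_) (sym (length-take k xs)) (⊓-glb i<k i<n)))

inc-ins-high : ∀ {i k} xs → k ≤ i → i ≤ length xs → inc k (ins i xs) ≡ inc k xs
inc-ins-high {i} {k} xs k≤i i≤n rewrite take-ins-≥ xs k≤i i≤n = cong not (hasInversion-map (take k xs))

any-take : ∀ (P : ℕ → Bool) {k l} xs → k ≤ l → any P (take l xs) ≡ false → any P (take k xs) ≡ false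
any-take P xs z≤n _ = refl
any-take P [] (s≤s k≤l) _ = refl
any-take P (x ∷ xs) (s≤s k≤l) eq =
  let p , q = ∨-≡-false eq in cong₂ _∨_ p (any-take P xs k≤l q)

hasInversion-take : ∀ {k l} xs → k ≤ l → hasInversion (take l xs) ≡ false → hasInversion (take k xs) ≡ false
hasInversion-take xs z≤n _ = refl
hasInversion-take [] (s≤s k≤l) _ = refl
hasInversion-take (x ∷ xs) (s≤s k≤l) eq =
  let p , q = ∨-≡-false eq in cong₂ _∨_ (any-take _ xs k≤l p) (hasInversion-take xs k≤l q)

-- An inversion among the first `k` entries is one among the first `l`, so the shorter test is
-- implied by the longer.
inc-absorb : ∀ {k l} xs b → k ≤ l → inc l xs ∧ (inc k xs ∧ b) ≡ inc l xs ∧ b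
inc-absorb {k} {l} xs b k≤l with hasInversion (take l xs) in eq
... | true = refl
... | false rewrite hasInversion-take xs k≤l eq = refl

maxList-map : ∀ x xs → maxList (map suc (x ∷ xs)) ≡ suc (maxList (x ∷ xs))
maxList-map x [] = cong suc (sym (⊔-identityʳ x))
maxList-map x (y ∷ ys) = cong (suc x ⊔_) (maxList-map y ys)

maxList-ins : ∀ i xs → maxList (ins i xs) ≡ suc (maxList xs)
maxList-ins zero [] = refl
maxList-ins zero (x ∷ xs) = cong (1 ⊔_) (maxList-map x xs)
maxList-ins (suc i) [] = refl
maxList-ins (suc i) (x ∷ xs) = cong (suc x ⊔_) (maxList-ins i xs)

firstLRMaxIs-map : ∀ N m xs → firstLRMaxIs (suc N) (suc m) (map suc xs) ≡ firstLRMaxIs N m xs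
firstLRMaxIs-map N m [] = refl
firstLRMaxIs-map N m (x ∷ xs) = cong (if m <ᵇ x then x ≡ᵇ N else_) (firstLRMaxIs-map N m xs)

firstLRMaxIs-ins : ∀ N m i xs → firstLRMaxIs (suc N) (suc m) (ins i xs) ≡ firstLRMaxIs N m xs
firstLRMaxIs-ins N m zero xs = firstLRMaxIs-map N m xs
firstLRMaxIs-ins N m (suc i) [] = refl
firstLRMaxIs-ins N m (suc i) (x ∷ xs) = cong (if m <ᵇ x then x ≡ᵇ N else_) (firstLRMaxIs-ins N m i xs)

wonAt-ins-low : ∀ N {i k} xs → i ≤ k → wonAt (suc N) (suc k) (ins i xs) ≡ wonAt N k xs
wonAt-ins-low N {i} {k} xs i≤k
  rewrite take-ins-≤ xs i≤k | drop-ins-≤ xs i≤k | maxList-ins i (take k xs) =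
  firstLRMaxIs-map N (maxList (take k xs)) (drop k xs)

-- The index is a successor so that some positive entry precedes the 1 and keeps it from being a
-- left-to-right maximum. At index 0 with `k` = 0 the 1 itself would be the next maximum.
wonAt-ins-high : ∀ N {i k} {xs} → Positive xs → k ≤ suc i → suc i ≤ length xs →
  wonAt (suc N) k (ins (suc i) xs) ≡ wonAt N k xs
wonAt-ins-high N (s≤s _ ∷ _) z≤n _ = refl
wonAt-ins-high N {i} {suc k} {x ∷ xs} _ (s≤s k≤i) (s≤s i≤n)
  rewrite take-ins-≥ xs k≤i i≤n | drop-ins-≥ xs k≤i i≤n | maxList-map x (take k xs) =
  firstLRMaxIs-ins N (maxList (x ∷ take k xs)) (i ∸ k) (drop k xs)

wonAt-beyond : ∀ N {k} xs → length xs ≤ k → wonAt N k xs ≡ false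
wonAt-beyond N {k} xs n≤k rewrite drop-all k xs n≤k = refl

won-child-high : ∀ {N i k π} → Avoider N π → k ≤ suc i → suc i ≤ N → (l : ℕ) → k ≤ l → l ≤ suc i →
  inc (suc i) π ∧ (inc l (ins (suc i) π) ∧ wonAt (suc N) k (ins (suc i) π)) ≡ inc (suc i) π ∧ wonAt N k π
won-child-high {N} {i} {k} {π} a k≤i i≤N l k≤l l≤i
  rewrite inc-ins-high π l≤i (fits a i≤N)
        | wonAt-ins-high N (positive a) k≤i (fits a i≤N) =
  inc-absorb π (wonAt N k π) l≤i

-- The first left-to-right maximum after position k would be π_{k+1} < π_{k+2} ≤ N.
¬won-ascent : ∀ N k {π} → Avoider N π → suc (suc k) ≤ N → inc (suc (suc k)) π ∧ wonAt N k π ≡ false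
¬won-ascent (suc N) k {π} a (s≤s k<N)
  with i , ρ , refl , r , i≤N , up ← Avoider-delete1 a = child i i≤N k k<N
  where
  child : ∀ i → i ≤ N → ∀ k → suc k ≤ N →
    inc (suc (suc k)) (ins i ρ) ∧ wonAt (suc N) k (ins i ρ) ≡ false
  -- The child opens with 1, which is the next left-to-right maximum; matching on 1 ≤ N shows that
  -- it differs from N+1.
  child zero _ zero (s≤s _) = ∧-zeroʳ _
  child zero _ (suc k) k<N
    rewrite inc-ins-zero (suc (suc k)) ρ | wonAt-ins-low N {0} {k} ρ z≤n = ¬won-ascent N k r k<N
  child (suc i) i≤N k k<N with <-cmp (suc i) (suc (suc k))
  ... | tri< i<k _ _ rewrite inc-ins-low {i} {suc k} (positive r) (s≤s⁻¹ i<k) (fits r i≤N) = refl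
  ... | tri≈ _ refl _
    rewrite inc-ins-high ρ (≤-refl {suc (suc k)}) (fits r i≤N)
          | wonAt-ins-high N {i} {k} (positive r) (m≤n+m k 2) (fits r i≤N) =
    ¬won-ascent N k r i≤N
  ... | tri> _ _ k<i
    rewrite inc-ins-high ρ (<⇒≤ k<i) (fits r i≤N)
          | wonAt-ins-high N {i} {k} (positive r) (≤-trans (m≤n+m k 2) (<⇒≤ k<i)) (fits r i≤N) =
    ¬won-ascent N k r (≤-trans (<⇒≤ k<i) i≤N)

-- Admissibility of `i` already forces an ascent right after position k+1. This is what bounds the
-- number of spikes in the numerator recurrences.
¬won-later : ∀ {N i k π} → Avoider N π → suc k < i → i ≤ N → inc i π ∧ wonAt N k π ≡ false
¬won-later {N} {i} {k} {π} a k<i i≤N = begin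
  inc i π ∧ wonAt N k π                          ≡⟨ inc-absorb π (wonAt N k π) k<i ⟨
  inc i π ∧ (inc (suc (suc k)) π ∧ wonAt N k π)  ≡⟨ cong (inc i π ∧_) (¬won-ascent N k a (≤-trans k<i i≤N)) ⟩
  inc i π ∧ false                                ≡⟨ ∧-zeroʳ (inc i π) ⟩
  false                                          ∎
  where open ≡-Reasoning

-- `wonMax` is M: when the first k+1 entries increase, entry k+1 is itself the next left-to-right
-- maximum after position `k`, so winning says that it equals `N`. Lists of length at most `k` are
-- excluded by `wonAt`.
increasing won wonMax : ℕ → ℕ → List ℕ → Bool
increasing N k π = inc k π
won N k π = inc k π ∧ wonAt N k π
wonMax N k π = inc (suc k) π ∧ wonAt N k π

# : (ℕ → ℕ → List ℕ → Bool) → ℕ → ℕ → ℕ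
# P N k = ∑ (Av N) (λ π → ⟦ P N k π ⟧)

-- Contribution of a single child to each count

won-beyond : ∀ {N k π} → Avoider N π → N ≤ k →
  ⟦ inc k π ∧ wonAt N k π ⟧ ≡ 0 × ⟦ inc (suc k) π ∧ wonAt N k π ⟧ ≡ 0
won-beyond {N} {k} {π} a N≤k rewrite wonAt-beyond N π (subst (_≤ k) (sym (size a)) N≤k) =
  cong ⟦_⟧ (∧-zeroʳ (inc k π)) , cong ⟦_⟧ (∧-zeroʳ (inc (suc k) π))

-- Index 0 lengthens the prefix of the parent by one, indices 1 to k put an inversion into it, and
-- beyond k+2 nothing is won. At k+2 admissibility asks for one more increasing entry than the
-- prefix does, which turns `won` into `wonMax`.
won-child : ∀ {N i π} k → Avoider N π → i ≤ N →
  ⟦ inc i π ∧ won (suc N) (suc k) (ins i π) ⟧ ≡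
  δ 0 ⟦ won N k π ⟧ i + (δ (suc k) ⟦ won N (suc k) π ⟧ i + δ (suc (suc k)) ⟦ wonMax N (suc k) π ⟧ i)
won-child {N} {zero} {π} k a i≤N
  rewrite inc-ins-zero k π | wonAt-ins-low N {0} {k} π z≤n = sym (+-identityʳ _)
won-child {N} {suc i} {π} k a i≤N with <-cmp (suc i) (suc k)
... | tri< i<k i≢k _
  rewrite inc-ins-low {i} {k} (positive a) (s≤s⁻¹ i<k) (fits a i≤N)
        | ∧-zeroʳ (inc (suc i) π)
        | δ-≢ ⟦ won N (suc k) π ⟧ i≢k | δ-≢ ⟦ wonMax N (suc k) π ⟧ (<⇒≢ (m<n⇒m<1+n i<k)) = refl
... | tri≈ _ refl _
  rewrite won-child-high a ≤-refl i≤N (suc k) ≤-refl ≤-refl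
        | δ-≡ k ⟦ won N (suc k) π ⟧ | δ-≢ ⟦ wonMax N (suc k) π ⟧ (<⇒≢ (n<1+n (suc k))) = sym (+-identityʳ _)
... | tri> _ i≢k k<i
  rewrite won-child-high a (<⇒≤ k<i) i≤N (suc k) ≤-refl (<⇒≤ k<i) | δ-≢ ⟦ won N (suc k) π ⟧ i≢k
  with <-cmp (suc i) (suc (suc k))
... | tri< i<k _ _ = ⊥-elim (<⇒≱ i<k k<i)
... | tri≈ _ refl _ = sym (δ-≡ i ⟦ wonMax N (suc k) π ⟧)
... | tri> _ i≢k′ k<i′ rewrite ¬won-later a k<i′ i≤N = sym (δ-≢ ⟦ wonMax N (suc k) π ⟧ i≢k′)

-- A smaller nonzero index breaks the increase of the first k+1 entries, and a larger one is
-- excluded by `¬won-later`.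
wonMax-child-suc : ∀ {N i π} k → Avoider N π → suc i ≤ N →
  ⟦ inc (suc i) π ∧ wonMax (suc N) k (ins (suc i) π) ⟧ ≡ δ (suc k) ⟦ wonMax N k π ⟧ (suc i)
wonMax-child-suc {N} {i} {π} k a i≤N with <-cmp (suc i) (suc k)
... | tri< i<k i≢k _
  rewrite inc-ins-low {i} {k} (positive a) (s≤s⁻¹ i<k) (fits a i≤N)
        | ∧-zeroʳ (inc (suc i) π) = sym (δ-≢ ⟦ wonMax N k π ⟧ i≢k)
... | tri≈ _ refl _
  rewrite won-child-high a (n≤1+n k) i≤N (suc k) (n≤1+n k) ≤-refl = sym (δ-≡ k ⟦ wonMax N k π ⟧)
... | tri> _ i≢k k<i
  rewrite won-child-high a (≤-trans (n≤1+n k) (<⇒≤ k<i)) i≤N (suc k) (n≤1+n k) (<⇒≤ k<i)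
        | ¬won-later a k<i i≤N = sym (δ-≢ ⟦ wonMax N k π ⟧ i≢k)

wonMax-child : ∀ {N i π} k → Avoider N π → i ≤ N →
  ⟦ inc i π ∧ wonMax (suc N) (suc k) (ins i π) ⟧ ≡
  δ 0 ⟦ wonMax N k π ⟧ i + δ (suc (suc k)) ⟦ wonMax N (suc k) π ⟧ i
wonMax-child {N} {zero} {π} k a i≤N
  rewrite inc-ins-zero (suc k) π | wonAt-ins-low N {0} {k} π z≤n = sym (+-identityʳ _)
wonMax-child {N} {suc i} {π} k a i≤N = wonMax-child-suc (suc k) a i≤N

wonMax-child-0 : ∀ {N i π} → Avoider (suc N) π → i ≤ suc N →
  ⟦ inc i π ∧ wonMax (suc (suc N)) 0 (ins i π) ⟧ ≡ δ 1 ⟦ wonMax (suc N) 0 π ⟧ i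
-- A child opening with 1 does not open with its maximum N+2.
wonMax-child-0 {N} {zero} {π} a i≤N = cong ⟦_⟧ (∧-zeroʳ (inc 1 (ins 0 π)))
wonMax-child-0 {N} {suc i} {π} a i≤N = wonMax-child-suc 0 a i≤N

-- Past index k+1 admissibility implies both prefix conditions, so those terms agree. The spikes
-- record the differences at 0 and k+1, placed so that no subtraction occurs.
increasing-child : ∀ {N i π} k → Avoider N π → i ≤ N →
  ⟦ inc i π ∧ increasing (suc N) (suc k) (ins i π) ⟧ + δ 0 ⟦ inc (suc k) π ⟧ i ≡
  ⟦ inc i π ∧ increasing (suc N) (suc (suc k)) (ins i π) ⟧ + (δ 0 ⟦ inc k π ⟧ i + δ (suc k) ⟦ inc (suc k) π ⟧ i)
increasing-child {N} {zero} {π} k a i≤N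
  rewrite inc-ins-zero k π | inc-ins-zero (suc k) π
        | +-identityʳ ⟦ inc k π ⟧ = +-comm ⟦ inc k π ⟧ ⟦ inc (suc k) π ⟧
increasing-child {N} {suc i} {π} k a i≤N
  rewrite +-identityʳ ⟦ inc (suc i) π ∧ inc (suc k) (ins (suc i) π) ⟧ with <-cmp (suc i) (suc k)
... | tri< i<k i≢k _
  rewrite inc-ins-low {i} {k} (positive a) (s≤s⁻¹ i<k) (fits a i≤N)
        | inc-ins-low {i} {suc k} (positive a) (<⇒≤ i<k) (fits a i≤N)
        | ∧-zeroʳ (inc (suc i) π) | δ-≢ ⟦ inc (suc k) π ⟧ i≢k = refl
... | tri≈ _ refl _
  rewrite inc-ins-low {i} {suc k} (positive a) ≤-refl (fits a i≤N)
        | inc-ins-high {suc k} {suc k} π ≤-refl (fits a i≤N)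
        | ∧-zeroʳ (inc (suc i) π) | δ-≡ k ⟦ inc (suc k) π ⟧ = cong ⟦_⟧ (∧-idem (inc (suc k) π))
... | tri> _ i≢k k<i
  rewrite inc-ins-high {suc i} {suc k} π (<⇒≤ k<i) (fits a i≤N)
        | inc-ins-high {suc i} {suc (suc k)} π k<i (fits a i≤N)
        | δ-≢ ⟦ inc (suc k) π ⟧ i≢k
        | +-identityʳ ⟦ inc (suc i) π ∧ inc (suc (suc k)) π ⟧ = cong ⟦_⟧ (trans (absorb (<⇒≤ k<i)) (sym (absorb k<i)))
  where
  absorb : ∀ {l} → l ≤ suc i → inc (suc i) π ∧ inc l π ≡ inc (suc i) π
  absorb {l} l≤i = trans (cong (inc (suc i) π ∧_) (sym (∧-identityʳ (inc l π))))
    (trans (inc-absorb π true l≤i) (∧-identityʳ (inc (suc i) π)))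

-- Recurrences and closed forms for increasing prefixes

∑-Av-cong : ∀ N {f g : List ℕ → ℕ} → (∀ {π} → Avoider N π → f π ≡ g π) → ∑ (Av N) f ≡ ∑ (Av N) g
∑-Av-cong N eq = ∑-cong (Av N) (eq ∘ ∈-Av⁻ N)

∑-positions-cong : ∀ N {f g : ℕ → ℕ} → (∀ {i} → i ≤ N → f i ≡ g i) → ∑ (upTo (suc N)) f ≡ ∑ (upTo (suc N)) g
∑-positions-cong N eq = ∑-cong (upTo (suc N)) (eq ∘ s≤s⁻¹ ∘ ∈-upTo⁻)

#won-suc : ∀ N k → # won (suc N) (suc k) ≡ # won N k + (# won N (suc k) + # wonMax N (suc k))
#won-suc N k = begin
  # won (suc N) (suc k)
    ≡⟨ ∑-Av-suc N (won (suc N) (suc k)) ⟩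
  ∑ (Av N) (λ π → ∑ (upTo (suc N)) (λ i → ⟦ inc i π ∧ won (suc N) (suc k) (ins i π) ⟧))
    ≡⟨ ∑-Av-cong N (λ a → trans (∑-positions-cong N (won-child k a)) (positions a)) ⟩
  ∑ (Av N) (λ π → ⟦ won N k π ⟧ + (⟦ won N (suc k) π ⟧ + ⟦ wonMax N (suc k) π ⟧))
    ≡⟨ trans (∑-+ _ _ (Av N)) (cong (# won N k +_) (∑-+ _ _ (Av N))) ⟩
  # won N k + (# won N (suc k) + # wonMax N (suc k)) ∎
  where
  open ≡-Reasoning
  positions : ∀ {x π} → Avoider N π → ∑ (upTo (suc N)) (λ i → δ 0 x i + (δ (suc k) ⟦ won N (suc k) π ⟧ i
    + δ (suc (suc k)) ⟦ wonMax N (suc k) π ⟧ i)) ≡ x + (⟦ won N (suc k) π ⟧ + ⟦ wonMax N (suc k) π ⟧)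
  positions {x} {π} a = trans (∑-+ (δ 0 x) (λ i → b i + c i) (upTo (suc N))) (cong₂ _+_ (∑-δ (suc N) 0 λ ())
    (trans (∑-+ b c (upTo (suc N))) (cong₂ _+_
      (∑-δ (suc N) (suc k) λ N<k → proj₁ (won-beyond a (≤-trans (n≤1+n N) N<k)))
      (∑-δ (suc N) (suc (suc k)) λ N<k → proj₂ (won-beyond a (s≤s⁻¹ N<k))))))
    where
    b c : ℕ → ℕ
    b = δ (suc k) ⟦ won N (suc k) π ⟧
    c = δ (suc (suc k)) ⟦ wonMax N (suc k) π ⟧

#wonMax-suc : ∀ N k → # wonMax (suc N) (suc k) ≡ # wonMax N k + # wonMax N (suc k)
#wonMax-suc N k = begin
  # wonMax (suc N) (suc k)
    ≡⟨ ∑-Av-suc N (wonMax (suc N) (suc k)) ⟩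
  ∑ (Av N) (λ π → ∑ (upTo (suc N)) (λ i → ⟦ inc i π ∧ wonMax (suc N) (suc k) (ins i π) ⟧))
    ≡⟨ ∑-Av-cong N (λ a → trans (∑-positions-cong N (wonMax-child k a)) (positions a)) ⟩
  ∑ (Av N) (λ π → ⟦ wonMax N k π ⟧ + ⟦ wonMax N (suc k) π ⟧)
    ≡⟨ ∑-+ _ _ (Av N) ⟩
  # wonMax N k + # wonMax N (suc k) ∎
  where
  open ≡-Reasoning
  positions : ∀ {x π} → Avoider N π → ∑ (upTo (suc N)) (λ i → δ 0 x i
    + δ (suc (suc k)) ⟦ wonMax N (suc k) π ⟧ i) ≡ x + ⟦ wonMax N (suc k) π ⟧
  positions {x} {π} a =
    trans (∑-+ (δ 0 x) (δ (suc (suc k)) ⟦ wonMax N (suc k) π ⟧) (upTo (suc N))) (cong₂ _+_ (∑-δ (suc N) 0 λ ())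
      (∑-δ (suc N) (suc (suc k)) λ N<k → proj₂ (won-beyond a (s≤s⁻¹ N<k))))

-- Only index 1 preserves a leading maximum. The recurrence starts at size 1 because the empty
-- permutation wins nothing while the single permutation of size 1 wins.
#wonMax-0 : ∀ N → # wonMax (suc (suc N)) 0 ≡ # wonMax (suc N) 0
#wonMax-0 N = trans (∑-Av-suc (suc N) (wonMax (suc (suc N)) 0))
  (∑-Av-cong (suc N) λ a → trans (∑-positions-cong (suc N) (wonMax-child-0 a))
    (∑-δ (suc (suc N)) 1 λ { (s≤s ()) }))

inc-1 : ∀ xs → inc 1 xs ≡ true
inc-1 [] = refl
inc-1 (x ∷ xs) = refl

#won-0 : ∀ N → # won N 0 ≡ # wonMax N 0
#won-0 N = ∑-cong (Av N) λ {π} _ → cong (λ b → ⟦ b ∧ wonAt N 0 π ⟧) (sym (inc-1 π))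

#increasing-0 : ∀ N → # increasing N 0 ≡ # increasing N 1
#increasing-0 N = ∑-cong (Av N) λ {π} _ → cong ⟦_⟧ (sym (inc-1 π))

-- Summing `increasing-child` leaves `# increasing N (suc k)` on both sides, to be cancelled. The
-- bound on `k` guarantees that index k+1 is among the positions summed over.
#increasing-suc : ∀ N k → suc k ≤ N →
  # increasing (suc N) (suc k) ≡ # increasing N k + # increasing (suc N) (suc (suc k))
#increasing-suc N k k<N = +-cancelʳ-≡ (# increasing N (suc k)) _ _ (begin
  # increasing (suc N) (suc k) + # increasing N (suc k)
    ≡⟨ cong (_+ # increasing N (suc k)) (∑-Av-suc N (inc (suc k))) ⟩
  ∑ (Av N) (λ π → ∑ (upTo (suc N)) (λ i → ⟦ inc i π ∧ inc (suc k) (ins i π) ⟧)) + # increasing N (suc k)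
    ≡⟨ ∑-+ _ _ (Av N) ⟨
  ∑ (Av N) (λ π → ∑ (upTo (suc N)) (λ i → ⟦ inc i π ∧ inc (suc k) (ins i π) ⟧) + ⟦ inc (suc k) π ⟧)
    ≡⟨ ∑-Av-cong N per-parent ⟩
  ∑ (Av N) (λ π → ∑ (upTo (suc N)) (λ i → ⟦ inc i π ∧ inc (suc (suc k)) (ins i π) ⟧) + (⟦ inc k π ⟧ + ⟦ inc (suc k) π ⟧))
    ≡⟨ trans (∑-+ _ _ (Av N)) (cong₂ _+_ (sym (∑-Av-suc N (inc (suc (suc k))))) (∑-+ _ _ (Av N))) ⟩
  # increasing (suc N) (suc (suc k)) + (# increasing N k + # increasing N (suc k))
    ≡⟨ rearrange (# increasing (suc N) (suc (suc k))) (# increasing N k) (# increasing N (suc k)) ⟩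
  # increasing N k + # increasing (suc N) (suc (suc k)) + # increasing N (suc k) ∎)
  where
  open ≡-Reasoning
  rearrange : ∀ a b c → a + (b + c) ≡ b + a + c
  rearrange = solve-∀
  per-parent : ∀ {π} → Avoider N π →
    ∑ (upTo (suc N)) (λ i → ⟦ inc i π ∧ inc (suc k) (ins i π) ⟧) + ⟦ inc (suc k) π ⟧ ≡
    ∑ (upTo (suc N)) (λ i → ⟦ inc i π ∧ inc (suc (suc k)) (ins i π) ⟧) + (⟦ inc k π ⟧ + ⟦ inc (suc k) π ⟧)
  per-parent {π} a = begin
    ∑ is f + ⟦ inc (suc k) π ⟧                                      ≡⟨ cong (∑ is f +_) (∑-δ (suc N) 0 λ ()) ⟨
    ∑ is f + ∑ is (δ 0 ⟦ inc (suc k) π ⟧)                           ≡⟨ ∑-+ f (δ 0 ⟦ inc (suc k) π ⟧) is ⟨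
    ∑ is (λ i → f i + δ 0 ⟦ inc (suc k) π ⟧ i)                      ≡⟨ ∑-positions-cong N (increasing-child k a) ⟩
    ∑ is (λ i → g i + (δ 0 ⟦ inc k π ⟧ i + δ (suc k) ⟦ inc (suc k) π ⟧ i))
      ≡⟨ trans (∑-+ g _ is)
           (cong (∑ is g +_) (∑-+ (δ 0 ⟦ inc k π ⟧) (δ (suc k) ⟦ inc (suc k) π ⟧) is)) ⟩
    ∑ is g + (∑ is (δ 0 ⟦ inc k π ⟧) + ∑ is (δ (suc k) ⟦ inc (suc k) π ⟧))
      ≡⟨ cong (∑ is g +_) (cong₂ _+_ (∑-δ (suc N) 0 λ ()) (∑-δ (suc N) (suc k) λ N<k → ⊥-elim (<⇒≱ k<N (s≤s⁻¹ N<k)))) ⟩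
    ∑ is g + (⟦ inc k π ⟧ + ⟦ inc (suc k) π ⟧) ∎
    where
    is : List ℕ
    is = upTo (suc N)
    f g : ℕ → ℕ
    f i = ⟦ inc i π ∧ inc (suc k) (ins i π) ⟧
    g i = ⟦ inc i π ∧ inc (suc (suc k)) (ins i π) ⟧

#increasing-all : ∀ N → # increasing N N ≡ 1
#increasing-all zero = refl
#increasing-all (suc N) = trans (∑-Av-suc N (inc (suc N)))
  (trans (∑-Av-cong N λ a → trans (∑-positions-cong N (child a)) (∑-δ (suc N) 0 λ ())) (#increasing-all N))
  where
  child : ∀ {π i} → Avoider N π → i ≤ N → ⟦ inc i π ∧ inc (suc N) (ins i π) ⟧ ≡ δ 0 ⟦ inc N π ⟧ i
  child {π} {zero} a _ = cong ⟦_⟧ (inc-ins-zero N π)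
  child {π} {suc i} a i≤N
    rewrite inc-ins-low (positive a) i≤N (fits a i≤N) = cong ⟦_⟧ (∧-zeroʳ (inc (suc i) π))

-- Combinatorially, the entries after the maximum must increase, so a counted permutation amounts to
-- a choice of the `k` values before it.
#wonMax-C : ∀ N k → # wonMax (suc N) k ≡ N C k
#wonMax-C zero zero = refl
#wonMax-C zero (suc k) = proj₁ (none k)
  where
  none : ∀ k → # wonMax 1 (suc k) ≡ 0 × # won 1 (suc k) ≡ 0
  none k rewrite drop-[] {A = ℕ} k | ∧-zeroʳ (inc (suc (suc k)) (1 ∷ [])) | ∧-zeroʳ (inc (suc k) (1 ∷ [])) = refl , refl
#wonMax-C (suc N) zero = trans (#wonMax-0 N) (#wonMax-C N zero)
#wonMax-C (suc N) (suc k) = begin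
  # wonMax (suc (suc N)) (suc k)                  ≡⟨ #wonMax-suc (suc N) k ⟩
  # wonMax (suc N) k + # wonMax (suc N) (suc k)   ≡⟨ cong₂ _+_ (#wonMax-C N k) (#wonMax-C N (suc k)) ⟩
  N C k + N C suc k                               ≡⟨ nCk+nC[k+1]≡[n+1]C[k+1] N k ⟩
  suc N C suc k                                   ∎
  where open ≡-Reasoning

-- In the induction step C(N,k+1) arises once from `won` and once from `wonMax`: one copy raises the
-- coefficient k to k+1, the other completes Pascal's rule for the last term.
#won-C : ∀ N k → # won (suc N) k ≡ k * (N C suc k) + N C k
#won-C N zero = trans (#won-0 (suc N)) (#wonMax-C N zero)
#won-C zero (suc k) rewrite drop-[] {A = ℕ} k | ∧-zeroʳ (inc (suc k) (1 ∷ [])) | *-zeroʳ (suc k) = refl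
#won-C (suc N) (suc k) = begin
  # won (suc (suc N)) (suc k)
    ≡⟨ #won-suc (suc N) k ⟩
  # won (suc N) k + (# won (suc N) (suc k) + # wonMax (suc N) (suc k))
    ≡⟨ cong₂ _+_ (#won-C N k) (cong₂ _+_ (#won-C N (suc k)) (#wonMax-C N (suc k))) ⟩
  k * (N C suc k) + N C k + (suc k * (N C suc (suc k)) + N C suc k + N C suc k)
    ≡⟨ regroup k (N C k) (N C suc k) (N C suc (suc k)) ⟩
  suc k * (N C suc k + N C suc (suc k)) + (N C k + N C suc k)
    ≡⟨ cong₂ (λ x y → suc k * x + y) (nCk+nC[k+1]≡[n+1]C[k+1] N (suc k)) (nCk+nC[k+1]≡[n+1]C[k+1] N k) ⟩
  suc k * (suc N C suc (suc k)) + suc N C suc k ∎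
  where
  open ≡-Reasoning
  regroup : ∀ k x y z → k * y + x + (suc k * z + y + y) ≡ suc k * (y + z) + (x + y)
  regroup = solve-∀

-- The absorption identity (k+1) C(n,k+1) = (n-k) C(n,k), freed of subtraction so that it holds for
-- all `n` and `k`.
[k+1]*nC[k+1]+k*nCk≡n*nCk : ∀ n k → suc k * (n C suc k) + k * (n C k) ≡ n * (n C k)
[k+1]*nC[k+1]+k*nCk≡n*nCk n zero rewrite nC1≡n n | +-identityʳ n | +-identityʳ n = sym (*-identityʳ n)
[k+1]*nC[k+1]+k*nCk≡n*nCk zero (suc k) rewrite *-zeroʳ k = refl
[k+1]*nC[k+1]+k*nCk≡n*nCk (suc n) (suc k) = begin
  suc (suc k) * (suc n C suc (suc k)) + suc k * (suc n C suc k)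
    ≡⟨ cong₂ (λ x y → suc (suc k) * x + suc k * y)
         (nCk+nC[k+1]≡[n+1]C[k+1] n (suc k)) (nCk+nC[k+1]≡[n+1]C[k+1] n k) ⟨
  suc (suc k) * (n C suc k + n C suc (suc k)) + suc k * (n C k + n C suc k)
    ≡⟨ expand k (n C k) (n C suc k) (n C suc (suc k)) ⟩
  suc (suc k) * (n C suc (suc k)) + suc k * (n C suc k) + (suc k * (n C suc k) + k * (n C k)) + (n C k + n C suc k)
    ≡⟨ cong₂ (λ x y → x + y + (n C k + n C suc k))
         ([k+1]*nC[k+1]+k*nCk≡n*nCk n (suc k)) ([k+1]*nC[k+1]+k*nCk≡n*nCk n k) ⟩
  n * (n C suc k) + n * (n C k) + (n C k + n C suc k)
    ≡⟨ collect n (n C k) (n C suc k) ⟩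
  suc n * (n C k + n C suc k)
    ≡⟨ cong (suc n *_) (nCk+nC[k+1]≡[n+1]C[k+1] n k) ⟩
  suc n * (suc n C suc k) ∎
  where
  open ≡-Reasoning
  expand : ∀ k x y z → suc (suc k) * (y + z) + suc k * (x + y) ≡
    suc (suc k) * z + suc k * y + (suc k * y + k * x) + (x + y)
  expand = solve-∀
  collect : ∀ n x y → n * y + n * x + (x + y) ≡ suc n * (x + y)
  collect = solve-∀

-- The reflection-principle form C(2N−k, N) − C(2N−k, N+1) of the ballot numbers, which needs only Pascal's rule.
#increasing-ballot : ∀ d k N → d + k ≡ N → # increasing N k + (d + N) C suc N ≡ (d + N) C N
#increasing-ballot zero k _ refl
  rewrite #increasing-all k | nCn≡1 k | k>n⇒nCk≡0 (n<1+n k) = refl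
#increasing-ballot (suc d) zero _ refl rewrite +-identityʳ d = begin
  # increasing (suc d) 0 + suc a C suc (suc d)
    ≡⟨ cong₂ _+_ (#increasing-0 (suc d)) (sym (nCk+nC[k+1]≡[n+1]C[k+1] a (suc d))) ⟩
  # increasing (suc d) 1 + (a C suc d + a C suc (suc d))
    ≡⟨ rearrange (# increasing (suc d) 1) (a C suc d) (a C suc (suc d)) ⟩
  a C suc d + (# increasing (suc d) 1 + a C suc (suc d))
    ≡⟨ cong₂ _+_ middle (#increasing-ballot d 1 (suc d) (+-comm d 1)) ⟩
  a C d + a C suc d
    ≡⟨ nCk+nC[k+1]≡[n+1]C[k+1] a d ⟩
  suc a C suc d ∎
  where
  open ≡-Reasoning
  a : ℕ
  a = d + suc d
  rearrange : ∀ x y z → x + (y + z) ≡ y + (x + z)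
  rearrange = solve-∀
  -- Here a = 2d+1, so these are the two equal central binomials. This symmetry is the boundary
  -- condition at `k` = 0.
  middle : a C suc d ≡ a C d
  middle = trans (cong (a C_) (sym (m+n∸m≡n d (suc d)))) (sym (nCk≡nC[n∸k] (m≤m+n d (suc d))))
-- The pair (d, k) with d = N-k descends lexicographically: lowering N and k together keeps d,
-- raising k alone lowers it.
#increasing-ballot (suc d) (suc k) _ refl = begin
  # increasing (suc M) (suc k) + suc a C suc (suc M)
    ≡⟨ cong₂ _+_ (#increasing-suc M k (m≤n+m (suc k) d)) (sym (nCk+nC[k+1]≡[n+1]C[k+1] a (suc M))) ⟩
  # increasing M k + # increasing (suc M) (suc (suc k)) + (a C suc M + a C suc (suc M))
    ≡⟨ rearrange (# increasing M k) (# increasing (suc M) (suc (suc k))) (a C suc M) (a C suc (suc M)) ⟩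
  (# increasing M k + a C suc M) + (# increasing (suc M) (suc (suc k)) + a C suc (suc M))
    ≡⟨ cong₂ _+_ (subst (λ b → # increasing M k + b C suc M ≡ b C M) (sym (+-suc d M))
                   (#increasing-ballot (suc d) k M (sym (+-suc d k))))
                 (#increasing-ballot d (suc (suc k)) (suc M) (+-suc d (suc k))) ⟩
  a C M + a C suc M
    ≡⟨ nCk+nC[k+1]≡[n+1]C[k+1] a M ⟩
  suc a C suc M ∎
  where
  open ≡-Reasoning
  M a : ℕ
  M = d + suc k
  a = d + suc M
  rearrange : ∀ w x y z → w + x + (y + z) ≡ (w + y) + (x + z)
  rearrange = solve-∀

-- By absorption, N+1 times the subtracted binomial is d times the main one, and N+1-d = k+1.
#increasing-closed : ∀ d k N → d + k ≡ N → suc N * # increasing N k ≡ suc k * ((d + N) C N)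
#increasing-closed d k N refl = +-cancelʳ-≡ (suc N * x) _ _ (begin
  suc N * # increasing N k + suc N * x   ≡⟨ *-distribˡ-+ (suc N) (# increasing N k) x ⟨
  suc N * (# increasing N k + x)         ≡⟨ cong (suc N *_) (#increasing-ballot d k N refl) ⟩
  suc N * y                              ≡⟨ split d k y ⟩
  suc k * y + d * y                      ≡⟨ cong (suc k * y +_) absorption ⟨
  suc k * y + suc N * x                  ∎)
  where
  open ≡-Reasoning
  x y : ℕ
  x = (d + N) C suc N
  y = (d + N) C N
  split : ∀ d k y → suc (d + k) * y ≡ suc k * y + d * y
  split = solve-∀
  absorption : suc N * x ≡ d * y
  absorption = +-cancelʳ-≡ (N * y) _ _ (trans ([k+1]*nC[k+1]+k*nCk≡n*nCk (d + N) N) (*-distribʳ-+ y d N))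

-- Restriction to a prefix

below : ℕ → List ℕ → ℕ
below v xs = length (filterᵇ (_<ᵇ v) xs)

below-map : ∀ {f : ℕ → ℕ} {v} xs → (∀ {x} → x ∈ xs → (f x <ᵇ f v) ≡ (x <ᵇ v)) →
  below (f v) (map f xs) ≡ below v xs
below-map [] _ = refl
below-map {v = v} (x ∷ xs) mono rewrite mono (here refl) with x <ᵇ v
... | true = cong suc (below-map xs (mono ∘ there))
... | false = below-map xs (mono ∘ there)

flatten-map : ∀ {f : ℕ → ℕ} xs → (∀ {x y} → x ∈ xs → y ∈ xs → (f x <ᵇ f y) ≡ (x <ᵇ y)) →
  flatten (map f xs) ≡ flatten xs
flatten-map {f} xs mono = trans (sym (map-∘ xs))
  (map-cong-local (All.tabulate λ y∈ → cong suc (below-map xs λ x∈ → mono x∈ y∈)))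

flatten-map-suc : ∀ xs → flatten (map suc xs) ≡ flatten xs
flatten-map-suc xs = flatten-map xs λ _ _ → refl

below-mono : ∀ {v w} xs → v ≤ w → below v xs ≤ below w xs
below-mono [] v≤w = z≤n
below-mono {v} {w} (x ∷ xs) v≤w with x <ᵇ v in eqv | x <ᵇ w in eqw
... | true  | true  = s≤s (below-mono xs v≤w)
... | true  | false = ⊥-elim (subst T eqw (<⇒<ᵇ (<-≤-trans (<ᵇ⇒< x v (from T-≡ eqv)) v≤w)))
... | false | true  = m≤n⇒m≤1+n (below-mono xs v≤w)
... | false | false = below-mono xs v≤w

below-strict : ∀ {v w} {xs} → v ∈ xs → v < w → below v xs < below w xs
below-strict {v} {w} {x ∷ xs} (here refl) v<w with v <ᵇ v in eqv | v <ᵇ w in eqw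
... | true  | _     = ⊥-elim (<-irrefl refl (<ᵇ⇒< v v (from T-≡ eqv)))
... | false | true  = s≤s (below-mono xs (<⇒≤ v<w))
... | false | false = ⊥-elim (subst T eqw (<⇒<ᵇ v<w))
below-strict {v} {w} {x ∷ xs} (there v∈) v<w with x <ᵇ v in eqv | x <ᵇ w in eqw
... | true  | true  = s≤s (below-strict v∈ v<w)
... | true  | false = ⊥-elim (subst T eqw (<⇒<ᵇ (<-trans (<ᵇ⇒< x v (from T-≡ eqv)) v<w)))
... | false | true  = m<n⇒m<1+n (below-strict v∈ v<w)
... | false | false = below-strict v∈ v<w

<⇒<ᵇ≡true : ∀ {m n} → m < n → (m <ᵇ n) ≡ true
<⇒<ᵇ≡true m<n = to T-≡ (<⇒<ᵇ m<n)

≥⇒<ᵇ≡false : ∀ {m n} → n ≤ m → (m <ᵇ n) ≡ false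
≥⇒<ᵇ≡false {m} {n} n≤m with m <ᵇ n in eq
... | true = ⊥-elim (<⇒≱ (<ᵇ⇒< m n (from T-≡ eq)) n≤m)
... | false = refl

-- Membership of `v` gives strictness: for a larger `w`, the entry `v` itself is newly counted.
-- Hence flattening preserves the order of the entries.
rank-<ᵇ : ∀ w {v} xs → v ∈ xs → (below v xs <ᵇ below w xs) ≡ (v <ᵇ w)
rank-<ᵇ w {v} xs v∈ with v <? w
... | yes v<w = trans (<⇒<ᵇ≡true (below-strict v∈ v<w)) (sym (<⇒<ᵇ≡true v<w))
... | no v≮w = trans (≥⇒<ᵇ≡false (below-mono xs (≮⇒≥ v≮w))) (sym (≥⇒<ᵇ≡false (≮⇒≥ v≮w)))

flatten-idem : ∀ xs → flatten (flatten xs) ≡ flatten xs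
flatten-idem xs = flatten-map xs λ {_} {w} v∈ _ → rank-<ᵇ w xs v∈

hasInversion-map-mono : ∀ {f : ℕ → ℕ} xs → (∀ {x y} → x ∈ xs → y ∈ xs → (f x <ᵇ f y) ≡ (x <ᵇ y)) →
  hasInversion (map f xs) ≡ hasInversion xs
hasInversion-map-mono [] mono = refl
hasInversion-map-mono {f} (x ∷ xs) mono = cong₂ _∨_
  (cong or (trans (sym (map-∘ xs)) (map-cong-local (All.tabulate λ y∈ → mono (there y∈) (here refl)))))
  (hasInversion-map-mono xs λ p q → mono (there p) (there q))

-- The ranks are taken in all of `xs` rather than in the prefix, but inversions depend only on
-- relative order.
hasInversion-take-flatten : ∀ i xs → hasInversion (take i (flatten xs)) ≡ hasInversion (take i xs)
hasInversion-take-flatten i xs = trans (cong hasInversion (take-map i xs))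
  (hasInversion-map-mono (take i xs) λ {_} {w} v∈ _ → rank-<ᵇ w xs (All.lookup (Allₚ.take⁺ i (All.tabulate id)) v∈))

length-flatten : ∀ xs → length (flatten xs) ≡ length xs
length-flatten xs = length-map _ xs

hasInversion-flatten : ∀ xs → hasInversion (flatten xs) ≡ hasInversion xs
hasInversion-flatten xs = begin
  hasInversion (flatten xs)                     ≡⟨ cong hasInversion (take-all n (flatten xs) (≤-reflexive (length-flatten xs))) ⟨
  hasInversion (take n (flatten xs))            ≡⟨ hasInversion-take-flatten n xs ⟩
  hasInversion (take n xs)                      ≡⟨ cong hasInversion (take-all n xs ≤-refl) ⟩
  hasInversion xs                               ∎
  where
  open ≡-Reasoning
  n : ℕ
  n = length xs

Positive-flatten : ∀ xs → Positive (flatten xs)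
Positive-flatten xs = Allₚ.map⁺ (All.tabulate λ _ → s≤s z≤n)

below-1-map : ∀ xs → below 1 (map suc xs) ≡ 0
below-1-map [] = refl
below-1-map (x ∷ xs) = below-1-map xs

below-1-ins : ∀ i {xs} → Positive xs → below 1 (ins i xs) ≡ 0
below-1-ins zero {xs} _ = below-1-map xs
below-1-ins (suc i) [] = refl
below-1-ins (suc i) (s≤s _ ∷ xs≥1) = below-1-ins i xs≥1

below-ins : ∀ i {v} xs → 1 ≤ v → below (suc v) (ins i xs) ≡ suc (below v xs)
below-ins zero xs (s≤s _) = cong suc (below-map xs λ _ → refl)
below-ins (suc i) [] (s≤s _) = refl
below-ins (suc i) {v} (x ∷ xs) 1≤v with x <ᵇ v
... | true = cong suc (below-ins i xs 1≤v)
... | false = below-ins i xs 1≤v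

flatten-ins : ∀ i {xs} → Positive xs → flatten (ins i xs) ≡ ins i (flatten xs)
flatten-ins i {xs} xs≥1 = ranks i xs≥1
  where
  shifted : ∀ {ys} → Positive ys → map (λ v → suc (below v (ins i xs))) (map suc ys) ≡ map suc (map (λ v → suc (below v xs)) ys)
  shifted [] = refl
  shifted (1≤y ∷ ys≥1) = cong₂ _∷_ (cong suc (below-ins i xs 1≤y)) (shifted ys≥1)
  -- The traversed list varies while ranks are still taken in the fixed list `ins i xs`; only so
  -- does the induction go through.
  ranks : ∀ j {ys} → Positive ys → map (λ v → suc (below v (ins i xs))) (ins j ys) ≡ ins j (map (λ v → suc (below v xs)) ys)
  ranks zero ys≥1 = cong₂ _∷_ (cong suc (below-1-ins i xs≥1)) (shifted ys≥1)
  ranks (suc j) [] = cong (_∷ []) (cong suc (below-1-ins i xs≥1))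
  ranks (suc j) (1≤y ∷ ys≥1) = cong₂ _∷_ (cong suc (below-ins i xs 1≤y)) (ranks j ys≥1)

restrict-ins-low : ∀ {i k π} → Positive π → i ≤ k → restrict (ins i π) (suc k) ≡ ins i (restrict π k)
restrict-ins-low {i} {k} {π} π≥1 i≤k =
  trans (cong flatten (take-ins-≤ π i≤k)) (flatten-ins i (Allₚ.take⁺ k π≥1))

restrict-ins-high : ∀ {i k} π → k ≤ i → i ≤ length π → restrict (ins i π) k ≡ restrict π k
restrict-ins-high {i} {k} π k≤i i≤n =
  trans (cong flatten (take-ins-≥ π k≤i i≤n)) (flatten-map-suc (take k π))

length-restrict : ∀ {N k π} → Avoider N π → k ≤ N → length (restrict π k) ≡ k
length-restrict {N} {k} {π} a k≤N = begin
  length (restrict π k)  ≡⟨ length-flatten (take k π) ⟩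
  length (take k π)      ≡⟨ length-take k π ⟩
  k ⊓ length π           ≡⟨ m≤n⇒m⊓n≡m (subst (k ≤_) (sym (size a)) k≤N) ⟩
  k                      ∎
  where open ≡-Reasoning

==-refl : ∀ xs → (xs == xs) ≡ true
==-refl [] = refl
==-refl (x ∷ xs) = cong₂ _∧_ (to T-≡ (≡⇒≡ᵇ x x refl)) (==-refl xs)

==⇒≡ : ∀ xs ys → (xs == ys) ≡ true → xs ≡ ys
==⇒≡ [] [] _ = refl
==⇒≡ (x ∷ xs) (y ∷ ys) eq with x ≡ᵇ y in x≡y
... | true = cong₂ _∷_ (≡ᵇ⇒≡ x y (from T-≡ x≡y)) (==⇒≡ xs ys eq)

==-map-suc : ∀ xs ys → (map suc xs == map suc ys) ≡ (xs == ys)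
==-map-suc [] [] = refl
==-map-suc [] (_ ∷ _) = refl
==-map-suc (_ ∷ _) [] = refl
==-map-suc (x ∷ xs) (y ∷ ys) = cong ((x ≡ᵇ y) ∧_) (==-map-suc xs ys)

==-ins : ∀ i j {xs ys} → Positive xs → Positive ys → i ≤ length xs → j ≤ length ys →
  (ins i xs == ins j ys) ≡ (i ≡ᵇ j) ∧ (xs == ys)
==-ins zero zero {xs} {ys} _ _ _ _ = ==-map-suc xs ys
==-ins zero (suc j) _ (s≤s _ ∷ _) _ _ = refl
==-ins (suc i) zero (s≤s _ ∷ _) _ _ _ = refl
==-ins (suc i) (suc j) {x ∷ xs} {y ∷ ys} (_ ∷ xs≥1) (_ ∷ ys≥1) (s≤s i≤) (s≤s j≤)
  rewrite ==-ins i j xs≥1 ys≥1 i≤ j≤ = ∧-swap (x ≡ᵇ y) (i ≡ᵇ j) (xs == ys)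
  where
  ∧-swap : ∀ a b c → a ∧ (b ∧ c) ≡ b ∧ (a ∧ c)
  ∧-swap true b c = refl
  ∧-swap false b c = sym (∧-zeroʳ b)

length-range1 : ∀ k → length (range1 k) ≡ k
length-range1 k = trans (length-map suc (upTo k)) (length-upTo k)

range1-suc : ∀ k → range1 (suc k) ≡ ins 0 (range1 k)
range1-suc k = cong (λ xs → 1 ∷ map suc xs) (sym (map-upTo suc k))

-- Induction along the tree. A 1 beyond the prefix leaves the pattern of the parent; a 1 inside it
-- must stand in front on either side of the equation.
restrict-range1 : ∀ N k {π} → Avoider N π → k ≤ N → (restrict π k == range1 k) ≡ inc k π
restrict-range1 N zero a _ = refl
restrict-range1 (suc N) (suc k) a (s≤s k≤N)
  with i , ρ , refl , r , i≤N , up ← Avoider-delete1 a with i ≤? k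
... | no i≰k = begin
  restrict (ins i ρ) (suc k) == range1 (suc k)
    ≡⟨ cong (_== range1 (suc k)) (restrict-ins-high ρ (≰⇒> i≰k) i≤n) ⟩
  restrict ρ (suc k) == range1 (suc k)
    ≡⟨ restrict-range1 N (suc k) r (≤-trans (≰⇒> i≰k) i≤N) ⟩
  inc (suc k) ρ
    ≡⟨ inc-ins-high ρ (≰⇒> i≰k) i≤n ⟨
  inc (suc k) (ins i ρ) ∎
  where
  open ≡-Reasoning
  i≤n : i ≤ length ρ
  i≤n = fits r i≤N
... | yes i≤k = begin
  restrict (ins i ρ) (suc k) == range1 (suc k)
    ≡⟨ cong₂ _==_ (restrict-ins-low (positive r) i≤k) (range1-suc k) ⟩
  ins i (restrict ρ k) == ins 0 (range1 k)
    ≡⟨ ==-ins i 0 (Positive-flatten (take k ρ)) (Allₚ.map⁺ (All.tabulate λ _ → s≤s z≤n))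
         (subst (i ≤_) (sym (length-restrict r k≤N)) i≤k) z≤n ⟩
  (i ≡ᵇ 0) ∧ (restrict ρ k == range1 k)
    ≡⟨ first i i≤k i≤N ⟩
  inc (suc k) (ins i ρ) ∎
  where
  open ≡-Reasoning
  first : ∀ i → i ≤ k → i ≤ N → (i ≡ᵇ 0) ∧ (restrict ρ k == range1 k) ≡ inc (suc k) (ins i ρ)
  first zero _ _ = trans (restrict-range1 N k r k≤N) (sym (inc-ins-zero k ρ))
  first (suc i) i≤k i≤N = sym (inc-ins-low (positive r) i≤k (fits r i≤N))

trigger-range1 : ∀ N {k} → k ≤ N → trigger N (range1 k) ≡ (# won N k , # increasing N k)
trigger-range1 N {k} k≤N = cong₂ _,_
  (trans (length-filterᵇ _ (Av N)) (∑-Av-cong N λ {π} a → cong ⟦_⟧ (trans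
    (cong (λ l → (restrict π l == range1 k) ∧ wonAt N l π) (length-range1 k))
    (cong (_∧ wonAt N k π) (restrict-range1 N k a k≤N)))))
  (trans (length-filterᵇ _ (Av N)) (∑-Av-cong N λ {π} a → cong ⟦_⟧ (trans
    (cong (λ l → restrict π l == range1 k) (length-range1 k))
    (restrict-range1 N k a k≤N))))

inc-take-restrict : ∀ {i k} π → i ≤ k → inc i (restrict π k) ≡ inc i π
inc-take-restrict {i} {k} π i≤k = cong not (trans (hasInversion-take-flatten i (take k π))
  (cong hasInversion (trans (take-take i k π) (cong (λ j → take j π) (m≤n⇒m⊓n≡m i≤k)))))

-- Prefixes with an inversion

module InvertedPrefix {N i₀ : ℕ} {q : List ℕ} (q≥1 : Positive q) (i₀≤ : i₀ ≤ length q) (q≤N : length q ≤ N)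
  (up₀ : inc i₀ q ≡ true) (inverted : hasInversion (ins i₀ q) ≡ true) where

  k : ℕ
  k = length q

  -- With i > k the prefix of the child is that of `π`, and its inversion contradicts admissibility
  -- of `i`. With i ≤ k the prefix contains the 1, so comparing it with `ins i₀ q` recovers both the
  -- index and the prefix of the parent.
  same-prefix : ∀ {π i} b → Avoider N π → i ≤ N →
    ⟦ inc i π ∧ ((restrict (ins i π) (suc k) == ins i₀ q) ∧ b) ⟧ ≡ δ i₀ ⟦ (restrict π k == q) ∧ b ⟧ i
  same-prefix {π} {i} b a i≤N with i ≤? k
  ... | no i≰k = trans (cong ⟦_⟧ disagree) (sym (δ-≢ {i} {i₀} ⟦ (restrict π k == q) ∧ b ⟧ λ { refl → i≰k i₀≤ }))
    where
    i≤n : i ≤ length π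
    i≤n = fits a i≤N
    disagree : inc i π ∧ ((restrict (ins i π) (suc k) == ins i₀ q) ∧ b) ≡ false
    disagree with restrict (ins i π) (suc k) == ins i₀ q in eq
    ... | false = ∧-zeroʳ (inc i π)
    ... | true = begin
      inc i π ∧ b                  ≡⟨ inc-absorb π b (≰⇒> i≰k) ⟨
      inc i π ∧ (inc (suc k) π ∧ b) ≡⟨ cong (λ c → inc i π ∧ (not c ∧ b)) descent ⟩
      inc i π ∧ false              ≡⟨ ∧-zeroʳ (inc i π) ⟩
      false                        ∎
      where
      open ≡-Reasoning
      descent : hasInversion (take (suc k) π) ≡ true
      descent = begin
        hasInversion (take (suc k) π)            ≡⟨ hasInversion-flatten (take (suc k) π) ⟨
        hasInversion (restrict π (suc k))        ≡⟨ cong hasInversion (restrict-ins-high π (≰⇒> i≰k) i≤n) ⟨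
        hasInversion (restrict (ins i π) (suc k)) ≡⟨ cong hasInversion (==⇒≡ (restrict (ins i π) (suc k)) (ins i₀ q) eq) ⟩
        hasInversion (ins i₀ q)                  ≡⟨ inverted ⟩
        true                                     ∎
  ... | yes i≤k rewrite restrict-ins-low (positive a) i≤k
    | ==-ins i i₀ (Positive-flatten (take k π)) q≥1 (subst (i ≤_) (sym (length-restrict a q≤N)) i≤k) i₀≤
    with i ≡ᵇ i₀ in eqi
  ... | false = cong ⟦_⟧ (∧-zeroʳ (inc i π))
  ... | true with restrict π k == q in eqr
  ...   | false = cong ⟦_⟧ (∧-zeroʳ (inc i π))
  -- Since i ≤ k, admissibility is decided by the prefix `q` alone, where it is known.
  ...   | true = cong (λ c → ⟦ c ∧ b ⟧) (begin
    inc i π               ≡⟨ inc-take-restrict π i≤k ⟨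
    inc i (restrict π k)  ≡⟨ cong₂ inc (≡ᵇ⇒≡ i i₀ (from T-≡ eqi)) (==⇒≡ (restrict π k) q eqr) ⟩
    inc i₀ q              ≡⟨ up₀ ⟩
    true                  ∎)
    where open ≡-Reasoning

  -- The weight serves both components of the pair: winning for the numerator, constant truth for
  -- the denominator.
  sum-over-prefix : (w w′ : List ℕ → Bool) → (∀ {i} π → i ≤ k → w (ins i π) ≡ w′ π) →
    ∑ (Av (suc N)) (λ π → ⟦ (restrict π (suc k) == ins i₀ q) ∧ w π ⟧) ≡
    ∑ (Av N) (λ π → ⟦ (restrict π k == q) ∧ w′ π ⟧)
  sum-over-prefix w w′ compat = trans (∑-Av-suc N _) (∑-Av-cong N λ {π} a →
    trans (∑-positions-cong N (step a)) (∑-δ (suc N) i₀ λ N<i₀ → ⊥-elim (<⇒≱ N<i₀ (≤-trans i₀≤ q≤N))))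
    where
    step : ∀ {π i} → Avoider N π → i ≤ N →
      ⟦ inc i π ∧ ((restrict (ins i π) (suc k) == ins i₀ q) ∧ w (ins i π)) ⟧ ≡ δ i₀ ⟦ (restrict π k == q) ∧ w′ π ⟧ i
    step {π} {i} a i≤N with i ≟ i₀
    ... | yes refl = trans (same-prefix (w (ins i π)) a i≤N)
      (cong (λ b → δ i ⟦ (restrict π k == q) ∧ b ⟧ i) (compat π i₀≤))
    ... | no i≢i₀ = trans (same-prefix (w (ins i π)) a i≤N) (trans (δ-≢ _ i≢i₀) (sym (δ-≢ _ i≢i₀)))

  trigger-ins : trigger (suc N) (ins i₀ q) ≡ trigger N q
  trigger-ins rewrite length-ins i₀ q = cong₂ _,_
    (begin
      length (filterᵇ (λ π → (restrict π (suc k) == ins i₀ q) ∧ wonAt (suc N) (suc k) π) (Av (suc N)))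
        ≡⟨ length-filterᵇ _ (Av (suc N)) ⟩
      ∑ (Av (suc N)) (λ π → ⟦ (restrict π (suc k) == ins i₀ q) ∧ wonAt (suc N) (suc k) π ⟧)
        ≡⟨ sum-over-prefix (wonAt (suc N) (suc k)) (wonAt N k) (λ π → wonAt-ins-low N π) ⟩
      ∑ (Av N) (λ π → ⟦ (restrict π k == q) ∧ wonAt N k π ⟧)
        ≡⟨ length-filterᵇ _ (Av N) ⟨
      length (filterᵇ (λ π → (restrict π k == q) ∧ wonAt N k π) (Av N)) ∎)
    (begin
      length (filterᵇ (λ π → restrict π (suc k) == ins i₀ q) (Av (suc N)))
        ≡⟨ counted (λ π → restrict π (suc k) == ins i₀ q) (Av (suc N)) ⟩
      ∑ (Av (suc N)) (λ π → ⟦ (restrict π (suc k) == ins i₀ q) ∧ true ⟧)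
        ≡⟨ sum-over-prefix (λ _ → true) (λ _ → true) (λ _ _ → refl) ⟩
      ∑ (Av N) (λ π → ⟦ (restrict π k == q) ∧ true ⟧)
        ≡⟨ counted (λ π → restrict π k == q) (Av N) ⟨
      length (filterᵇ (λ π → restrict π k == q) (Av N)) ∎)
    where
    open ≡-Reasoning
    counted : (P : List ℕ → Bool) → ∀ πs → length (filterᵇ P πs) ≡ ∑ πs (λ π → ⟦ P π ∧ true ⟧)
    counted P πs = trans (length-filterᵇ P πs) (∑-cong πs λ {π} _ → cong ⟦_⟧ (sym (∧-identityʳ (P π))))

filter-≢1-map-suc : ∀ {xs} → Positive xs → filterᵇ (λ x → not (x ≡ᵇ 1)) (map suc xs) ≡ map suc xs
filter-≢1-map-suc [] = refl
filter-≢1-map-suc (s≤s _ ∷ xs≥1) = cong (_ ∷_) (filter-≢1-map-suc xs≥1)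

filter-≢1-ins : ∀ i {xs} → Positive xs → filterᵇ (λ x → not (x ≡ᵇ 1)) (ins i xs) ≡ map suc xs
filter-≢1-ins zero xs≥1 = filter-≢1-map-suc xs≥1
filter-≢1-ins (suc i) [] = refl
filter-≢1-ins (suc i) (s≤s _ ∷ xs≥1) = cong (_ ∷_) (filter-≢1-ins i xs≥1)

removeOne-ins : ∀ i {xs} → Positive xs → removeOne (ins i xs) ≡ flatten xs
removeOne-ins i {xs} xs≥1 = trans (cong flatten (filter-≢1-ins i xs≥1)) (flatten-map-suc xs)

-- A permutation witnessing the prefix supplies the index of the 1. That index lies inside the
-- prefix, because everything before an admissible index increases.
trigger-removeOne : ∀ N k {π} → Avoider (suc N) π → k ≤ N → hasInversion (restrict π k) ≡ true →
  trigger (suc N) (restrict π k) ≡ trigger N (removeOne (restrict π k))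
trigger-removeOne N k a k≤N inverted
  with i , ρ , refl , r , i≤N , up ← Avoider-delete1 a with k ≤? i
... | yes k≤i = ⊥-elim (subst T true≡false tt)
  where
  open ≡-Reasoning
  true≡false : true ≡ false
  true≡false = begin
    true                                ≡⟨ inverted ⟨
    hasInversion (restrict (ins i ρ) k) ≡⟨ cong hasInversion (restrict-ins-high ρ k≤i (fits r i≤N)) ⟩
    hasInversion (restrict ρ k)         ≡⟨ hasInversion-flatten (take k ρ) ⟩
    hasInversion (take k ρ)             ≡⟨ hasInversion-take ρ k≤i (not≡true⇒≡false up) ⟩
    false                               ∎
... | no k≰i = within k k≤N (≰⇒> k≰i) inverted
  where
  within : ∀ k → k ≤ N → i < k → hasInversion (restrict (ins i ρ) k) ≡ true →
    trigger (suc N) (restrict (ins i ρ) k) ≡ trigger N (removeOne (restrict (ins i ρ) k))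
  within (suc k) k<N (s≤s i≤k) inverted = begin
    trigger (suc N) (restrict (ins i ρ) (suc k))       ≡⟨ cong (trigger (suc N)) prefix ⟩
    trigger (suc N) (ins i q)                          ≡⟨ InvertedPrefix.trigger-ins q≥1 (subst (i ≤_) (sym len) i≤k)
                                                           (subst (_≤ N) (sym len) k≤N′)
                                                           (trans (inc-take-restrict ρ i≤k) up)
                                                           (trans (cong hasInversion (sym prefix)) inverted) ⟩
    -- `removeOne` flattens once more, which leaves the already flattened `q` unchanged.
    trigger N q                                        ≡⟨ cong (trigger N) (flatten-idem (take k ρ)) ⟨
    trigger N (flatten q)                              ≡⟨ cong (trigger N) (removeOne-ins i q≥1) ⟨
    trigger N (removeOne (ins i q))                    ≡⟨ cong (trigger N ∘ removeOne) prefix ⟨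
    trigger N (removeOne (restrict (ins i ρ) (suc k))) ∎
    where
    open ≡-Reasoning
    q : List ℕ
    q = restrict ρ k
    q≥1 : Positive q
    q≥1 = Positive-flatten (take k ρ)
    k≤N′ : k ≤ N
    k≤N′ = <⇒≤ k<N
    len : length q ≡ k
    len = length-restrict r k≤N′
    prefix : restrict (ins i ρ) (suc k) ≡ ins i q
    prefix = restrict-ins-low (positive r) i≤k

theorem4p13 : (N : ℕ) → 2 ≤ N →
    ((p : List ℕ) → length p < N → IsPrefix N p → hasInversion p ≡ true →
    trigger N p ≡ trigger (N ∸ 1) (removeOne p))
    ×
    ((k : ℕ) → k < N →
    (proj₁ (trigger N (range1 k)) ≡ k * ((N ∸ 1) C (k + 1)) + (N ∸ 1) C k)
    × ((N + 1) * proj₂ (trigger N (range1 k)) ≡ (k + 1) * ((2 * N ∸ k) C N)))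
theorem4p13 (suc N) _ = inverted-prefixes , λ k k<N → numerator k k<N , denominator k k<N
  where
  open ≡-Reasoning
  inverted-prefixes : (p : List ℕ) → length p < suc N → IsPrefix (suc N) p → hasInversion p ≡ true →
    trigger (suc N) p ≡ trigger N (removeOne p)
  inverted-prefixes p (s≤s p≤N) (π , π∈ , prefix) inverted =
    subst (λ p → trigger (suc N) p ≡ trigger N (removeOne p)) prefix
      (trigger-removeOne N (length p) (∈-Av⁻ (suc N) π∈) p≤N (trans (cong hasInversion prefix) inverted))
  numerator : ∀ k → k < suc N → proj₁ (trigger (suc N) (range1 k)) ≡ k * (N C (k + 1)) + N C k
  numerator k k<N = begin
    proj₁ (trigger (suc N) (range1 k))  ≡⟨ cong proj₁ (trigger-range1 (suc N) (<⇒≤ k<N)) ⟩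
    # won (suc N) k                     ≡⟨ #won-C N k ⟩
    k * (N C suc k) + N C k             ≡⟨ cong (λ l → k * (N C l) + N C k) (+-comm 1 k) ⟩
    k * (N C (k + 1)) + N C k           ∎
  denominator : ∀ k → k < suc N →
    (suc N + 1) * proj₂ (trigger (suc N) (range1 k)) ≡ (k + 1) * ((2 * suc N ∸ k) C suc N)
  denominator k k<N = begin
    (suc N + 1) * proj₂ (trigger (suc N) (range1 k))
      ≡⟨ cong₂ _*_ (+-comm (suc N) 1) (cong proj₂ (trigger-range1 (suc N) k≤N)) ⟩
    suc (suc N) * # increasing (suc N) k
      ≡⟨ #increasing-closed (suc N ∸ k) k (suc N) (m∸n+n≡m k≤N) ⟩
    suc k * ((suc N ∸ k + suc N) C suc N)
      ≡⟨ cong₂ (λ x y → x * (y C suc N)) (+-comm 1 k) top ⟩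
    (k + 1) * ((2 * suc N ∸ k) C suc N) ∎
    where
    k≤N : k ≤ suc N
    k≤N = <⇒≤ k<N
    top : suc N ∸ k + suc N ≡ 2 * suc N ∸ k
    top = begin
      suc N ∸ k + suc N    ≡⟨ +-∸-comm (suc N) k≤N ⟨
      suc N + suc N ∸ k    ≡⟨ cong (λ m → suc N + m ∸ k) (+-identityʳ (suc N)) ⟨
      2 * suc N ∸ k        ∎
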